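{- Let $\mathcal{F}$ be a family of finite graded vertically indecomposable lattices that is closed under vertical 2-sum. For $n\ge1$ let $f_{\mathrm{vi}}(n)$ be the number of $n$-element lattices in $\mathcal{F}$ and $f_{\mathrm{pc}}(n)$ the number of $n$-element pieces in $\mathcal{F}$ (both counted up to isomorphism). Let $N\ge 6$ be an integer and let $\underline{f}\colon\mathbb{N}^+\to\mathbb{N}$ be defined by $\underline{f}(n)=f_{\mathrm{pc}}(n)$ for $1\le n\le 6$, $$\underline{f}(n) = f_{\mathrm{pc}}(n) + \sum_{k=6}^{n-1} f_{\mathrm{pc}}(k)\,\underline{f}(n-k+4)\quad\text{for } 7\le n\le N,$$ and $$\underline{f}(n) = \sum_{k=6}^{N} f_{\mathrm{pc}}(k)\,\underline{f}(n-k+4)\quad\text{for } n\ge N+1.$$ Then $f_{\mathrm{vi}}(n)\ge \underline{f}(n)$ for all $n\ge 1$.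
   Context: All lattices are finite, nonempty and unlabeled. A knot of a lattice $X$ is an element distinct from top and bottom and comparable to all elements; $X$ is vertically indecomposable (a vi-lattice) if it has no knot. A finite lattice is graded if all its maximal chains have the same length; the rank of an element is the length of a maximal chain from the bottom to it. For lattices $L$ with exactly two coatoms and $U$ with exactly two atoms, a vertical 2-sum of $L$ and $U$ is the poset obtained from the disjoint union of $L\setminus\{\top_L\}$ and $U\setminus\{\bot_U\}$ by identifying the two coatoms of $L$ with the two atoms of $U$ via some bijection, the order being the transitive closure of the union of the two orders; it is a lattice with $|L|+|U|-4$ elements. $\mathcal{F}$ is closed under vertical 2-sum if whenever $L,U\in\mathcal{F}$, $L$ has exactly two coatoms and $U$ has exactly two atoms, $\mathcal{F}$ contains a vertical 2-sum of $L$ and $U$. In a graded lattice $X$, two elements form a neck if (1) they have the same rank, (2) they are the only elements of that rank, and (3) they are neither atoms nor coatoms. A piece is a graded vi-lattice that has exactly two atoms, exactly two coatoms, no neck, and rank at least three (so a piece has at least six elements). -}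

module Defs where

open import Data.Nat using (ℕ; zero; suc; _+_; _*_; _∸_; _≤_; _<_; _≤ᵇ_)
open import Data.Bool using (Bool; true; false; if_then_else_)
open import Data.Fin using (Fin)
open import Data.List using (List; length)
open import Data.List.Membership.Propositional using (_∈_; _∉_)
open import Data.List.Relation.Unary.All using (All)
open import Data.List.Relation.Unary.Linked using (Linked)
open import Data.Product using (Σ; _×_; _,_; proj₁)
open import Data.Sum using (_⊎_; inj₁; inj₂)
open import Data.Unit using (⊤)
open import Relation.Nullary using (¬_)
open import Relation.Binary.PropositionalEquality using (_≡_; _≢_)
open import Relation.Binary.Construct.Closure.Transitive using (TransClosure)
open import Function.Bundles using (_↔_; Inverse)

record FinPoset (n : ℕ) : Set where
  field
    le      : Fin n → Fin n → Bool
    reflexive : ∀ x → le x x ≡ true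
    antisym : ∀ x y → le x y ≡ true → le y x ≡ true → x ≡ y
    transitive : ∀ x y z → le x y ≡ true → le y z ≡ true → le x z ≡ true

open FinPoset public

module _ {n : ℕ} (P : FinPoset n) where

  Leq : Fin n → Fin n → Set
  Leq x y = le P x y ≡ true

  Lt : Fin n → Fin n → Set
  Lt x y = Leq x y × x ≢ y

  Comparable : Fin n → Fin n → Set
  Comparable x y = Leq x y ⊎ Leq y x

  IsTop : Fin n → Set
  IsTop t = ∀ x → Leq x t

  IsBot : Fin n → Set
  IsBot b = ∀ x → Leq b x

  IsAtom : Fin n → Set
  IsAtom a = ¬ IsBot a × (∀ z → Leq z a → z ≡ a ⊎ IsBot z)

  IsCoatom : Fin n → Set
  IsCoatom c = ¬ IsTop c × (∀ z → Leq c z → z ≡ c ⊎ IsTop z)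

  ExactlyTwo : (Fin n → Set) → Set
  ExactlyTwo Q = Σ (Fin n) λ a → Σ (Fin n) λ b →
    a ≢ b × Q a × Q b × (∀ c → Q c → c ≡ a ⊎ c ≡ b)

  IsJoin : Fin n → Fin n → Fin n → Set
  IsJoin x y z = Leq x z × Leq y z × (∀ w → Leq x w → Leq y w → Leq z w)

  IsMeet : Fin n → Fin n → Fin n → Set
  IsMeet x y z = Leq z x × Leq z y × (∀ w → Leq w x → Leq w y → Leq w z)

  IsLattice : Set
  IsLattice = (0 < n) × (∀ x y → Σ (Fin n) (IsJoin x y) × Σ (Fin n) (IsMeet x y))

  -- A chain, listed in strictly increasing order; its length is (#elements - 1).
  -- MaxChainIn S l : l is a chain inside the subset S, maximal among chains in S.
  MaxChainIn : (Fin n → Set) → List (Fin n) → Set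
  MaxChainIn S l = Linked Lt l × All S l ×
    (∀ z → S z → z ∉ l → Σ (Fin n) λ y → y ∈ l × ¬ Comparable z y)

  MaxChain : List (Fin n) → Set
  MaxChain = MaxChainIn (λ _ → ⊤)

  Graded : Set
  Graded = ∀ l l' → MaxChain l → MaxChain l' → length l ≡ length l'

  HasRank : Fin n → ℕ → Set
  HasRank x r = Σ (List (Fin n)) λ l → MaxChainIn (λ z → Leq z x) l × length l ≡ suc r

  IsKnot : Fin n → Set
  IsKnot x = ¬ IsTop x × ¬ IsBot x × (∀ y → Comparable x y)

  VI : Set
  VI = ¬ Σ (Fin n) IsKnot

  IsNeck : Fin n → Fin n → Set
  IsNeck x y = Σ ℕ λ r → x ≢ y × HasRank x r × HasRank y r ×
    (∀ z → HasRank z r → z ≡ x ⊎ z ≡ y) ×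
    ¬ IsAtom x × ¬ IsAtom y × ¬ IsCoatom x × ¬ IsCoatom y

  HasNeck : Set
  HasNeck = Σ (Fin n) λ x → Σ (Fin n) λ y → IsNeck x y

  RankAtLeast3 : Set
  RankAtLeast3 = Σ (List (Fin n)) λ l → MaxChain l × 4 ≤ length l

  IsPiece : Set
  IsPiece = IsLattice × Graded × VI × ExactlyTwo IsAtom × ExactlyTwo IsCoatom ×
            ¬ HasNeck × RankAtLeast3

Iso : {n m : ℕ} → FinPoset n → FinPoset m → Set
Iso {n} {m} P Q = Σ (Fin n ↔ Fin m) λ σ →
  ∀ x y → le P x y ≡ le Q (Inverse.to σ x) (Inverse.to σ y)

-- Vertical 2-sum.  S is a vertical 2-sum of L and U if S is (up to the
-- labelling given by π) the disjoint union of L ∖ {top} and U ∖ {bottom}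
-- with the two coatoms of L identified bijectively with the two atoms of U,
-- ordered by the transitive closure of the union of the two orders.

module _ {nL nU nS : ℕ} (L : FinPoset nL) (U : FinPoset nU) (S : FinPoset nS) where

  L⁻ : Set
  L⁻ = Σ (Fin nL) λ x → ¬ IsTop L x

  U⁻ : Set
  U⁻ = Σ (Fin nU) λ y → ¬ IsBot U y

  UnionRel : (L⁻ ⊎ U⁻ → Fin nS) → Fin nS → Fin nS → Set
  UnionRel π s t =
    (Σ L⁻ λ a → Σ L⁻ λ a' → π (inj₁ a) ≡ s × π (inj₁ a') ≡ t × Leq L (proj₁ a) (proj₁ a'))
    ⊎ (Σ U⁻ λ b → Σ U⁻ λ b' → π (inj₂ b) ≡ s × π (inj₂ b') ≡ t × Leq U (proj₁ b) (proj₁ b'))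

  IsVertical2Sum : Set
  IsVertical2Sum = Σ (L⁻ ⊎ U⁻ → Fin nS) λ π →
    (∀ s → Σ (L⁻ ⊎ U⁻) λ p → π p ≡ s) ×
    (∀ a a' → π (inj₁ a) ≡ π (inj₁ a') → proj₁ a ≡ proj₁ a') ×
    (∀ b b' → π (inj₂ b) ≡ π (inj₂ b') → proj₁ b ≡ proj₁ b') ×
    (∀ a b → π (inj₁ a) ≡ π (inj₂ b) → IsCoatom L (proj₁ a) × IsAtom U (proj₁ b)) ×
    (∀ a → IsCoatom L (proj₁ a) → Σ U⁻ λ b → π (inj₁ a) ≡ π (inj₂ b)) ×
    (∀ b → IsAtom U (proj₁ b) → Σ L⁻ λ a → π (inj₁ a) ≡ π (inj₂ b)) ×
    (∀ s t → (Leq S s t → TransClosure (UnionRel π) s t) × (TransClosure (UnionRel π) s t → Leq S s t))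

Family : Set₁
Family = ∀ {n} → FinPoset n → Set

ClosedUnderV2Sum : Family → Set
ClosedUnderV2Sum F = ∀ {nL nU} (L : FinPoset nL) (U : FinPoset nU) →
  F L → F U → ExactlyTwo L (IsCoatom L) → ExactlyTwo U (IsAtom U) →
  Σ ℕ λ nS → Σ (FinPoset nS) λ S → F S × IsVertical2Sum L U S

IsoCount : (n : ℕ) → (FinPoset n → Set) → ℕ → Set
IsoCount n P c = Σ (Fin c → FinPoset n) λ reps →
  (∀ i → P (reps i)) ×
  (∀ i j → Iso (reps i) (reps j) → i ≡ j) ×
  (∀ X → P X → Σ (Fin c) λ i → Iso X (reps i))

sumRange : ℕ → ℕ → (ℕ → ℕ) → ℕ
sumRange a zero    g = 0
sumRange a (suc l) g = g a + sumRange (suc a) l g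

-- fuel-bounded recursion; arguments of recursive calls are ≤ fuel
lowerAux : (ℕ → ℕ) → ℕ → ℕ → ℕ → ℕ
lowerAux fpc N zero    n = 0
lowerAux fpc N (suc t) n =
  if n ≤ᵇ 6 then fpc n
  else if n ≤ᵇ N
    -- sum over k = 6 .. n-1  (n ∸ 6 terms)
    then fpc n + sumRange 6 (n ∸ 6) (λ k → fpc k * lowerAux fpc N t ((n ∸ k) + 4))
    -- sum over k = 6 .. N  (N ∸ 5 terms)
    else sumRange 6 (N ∸ 5) (λ k → fpc k * lowerAux fpc N t ((n ∸ k) + 4))

lowerF : (ℕ → ℕ) → ℕ → ℕ → ℕ
lowerF fpc N n = lowerAux fpc N n n

{-# OPTIONS --safe #-}
module Submission where

-- A vertical 2-sum S of a piece L and a lattice U has the two glued elements as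
-- a neck, and L and U can be read off S together with this pair as its lower and
-- upper parts.  If S is glued in two ways, both necks have a rank in the graded
-- lattice S.  Were the ranks different, the lower neck would be a neck of the
-- bottom piece of the other gluing; so the ranks agree, hence so do the necks and
-- the parts.  Thus a stack of pieces determines its bottom piece and the rest up
-- to isomorphism, and stacks of pieces counted by the recursion are pairwise
-- non-isomorphic members of F.

open import Defs
open import Data.Bool using (true; false)
open import Data.Bool.Properties using (⇔→≡) renaming (_≟_ to _≟ᵇ_)
open import Data.Empty using (⊥; ⊥-elim)
open import Data.Fin using (Fin; zero; suc; fromℕ<; splitAt; join; remQuot; combine)
open import Data.Fin.Induction using (po-wellFounded; Acc; acc)
open import Data.Fin.Permutation using (↔⇒≡)
open import Data.Fin.Properties
  using (_≟_; any?; injective⇒≤; splitAt-join; join-splitAt; combine-remQuot)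
open import Data.List using (List; []; _∷_; length)
open import Data.List.Membership.Propositional using (_∈_; _∉_)
open import Data.List.Relation.Unary.All as All using (All; []; _∷_)
open import Data.List.Relation.Unary.Any using (here; there)
open import Data.List.Relation.Unary.Linked using (Linked; []; [-]; _∷_)
open import Data.Nat using (ℕ; zero; suc; _+_; _*_; _∸_; _≤_; _<_; z≤n; s≤s; _≤ᵇ_)
open import Data.Nat.Properties
  using ( suc-injective; <-cmp; <⇒≢; <⇒≱; <⇒≤; ≰⇒>; <⇒≤pred; ≤-refl; ≤-trans; ≤-antisym
        ; ≤ᵇ-reflects-≤; m≤m+n; m≤n+m; m<m+n; m≢1+m+n; m+[n∸m]≡n
        ; +-comm; +-assoc; +-suc; +-cancelʳ-≡)
open import Data.Product using (Σ; ∃; _×_; _,_; proj₁; proj₂)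
open import Data.Sum as Sum using (_⊎_; inj₁; inj₂; [_,_]′)
open import Data.Unit using (tt)
open import Function.Base using (_∘_)
open import Function.Bundles using (Inverse; mk↔ₛ′; mk⇔)
open import Function.Construct.Composition using (_↔-∘_)
open import Level using (Level)
open import Relation.Binary.Construct.Closure.Transitive using (TransClosure; [_]; _∷_)
open import Relation.Binary.Definitions using (tri<; tri≈; tri>)
open import Relation.Binary.PropositionalEquality
  using (_≡_; _≢_; refl; sym; trans; cong; cong₂; subst; isEquivalence)
open import Relation.Binary.Structures using (IsPartialOrder)
open import Relation.Nullary using (¬_; Dec; yes; no; ofⁿ)
open import Relation.Nullary.Decidable using (_×-dec_; _⊎-dec_; ¬?)

-- Chains and covering paths

-- The upper summand may itself be a stack with many necks, so absence of necks is available only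
-- for the lower summand; this is why a stack is taken apart from below. A neck must also avoid
-- atoms and coatoms. For the glued pair it suffices that neither summand has an element which is an
-- atom and a coatom at once, a condition that, unlike being a piece, passes on to the sum and so
-- supports the induction. Closure under vertical 2-sum yields one sum for each pair, with an
-- uncontrolled bijection and an unspecified number of elements. A piece and an upper lattice
-- therefore contribute exactly one stack, whence the products in the recursion, and the size of the
-- sum has to be computed from the gluing. Statements about `U` are statements about a lower summand
-- in the opposite order.

dual : ∀ {n} → FinPoset n → FinPoset n
dual P = record
  { le         = λ x y → le P y x
  ; reflexive  = reflexive P
  ; antisym    = λ x y p q → antisym P x y q p
  ; transitive = λ x y z p q → transitive P z y x q p
  }

module _ {n} (P : FinPoset n) where

  Leq-reflexive : ∀ {x y} → x ≡ y → Leq P x y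
  Leq-reflexive {x} refl = reflexive P x

  Leq-trans : ∀ {x y z} → Leq P x y → Leq P y z → Leq P x z
  Leq-trans = transitive P _ _ _

  Leq-antisym : ∀ {x y} → Leq P x y → Leq P y x → x ≡ y
  Leq-antisym = antisym P _ _

  Leq-isPartialOrder : IsPartialOrder _≡_ (Leq P)
  Leq-isPartialOrder = record
    { isPreorder = record
      { isEquivalence = isEquivalence
      ; reflexive     = Leq-reflexive
      ; trans         = Leq-trans
      }
    ; antisym = Leq-antisym
    }

  Lt? : ∀ x y → Dec (Lt P x y)
  Lt? x y = (le P x y ≟ᵇ true) ×-dec ¬? (x ≟ y)

  IsTop-unique : ∀ {t t'} → IsTop P t → IsTop P t' → t ≡ t'
  IsTop-unique top top' = Leq-antisym (top' _) (top _)

  IsTop-Leq : ∀ {x y} → IsTop P x → Leq P x y → IsTop P y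
  IsTop-Leq tx x≤y z = Leq-trans (tx z) x≤y

  IsTop? : ∀ {t} → IsTop P t → ∀ x → Dec (IsTop P x)
  IsTop? {t} top x with x ≟ t
  ... | yes refl = yes top
  ... | no x≢t   = no λ tx → x≢t (IsTop-unique tx top)

  -- Upper bounds are folded over an enumeration of all elements; `0 < n` provides the start value.
  directed⇒top : (∀ x y → ∃ λ z → Leq P x z × Leq P y z) → 0 < n → ∃ (IsTop P)
  directed⇒top ub 0<n = bound (λ x → x)
    where
    bound : ∀ {k} (f : Fin k → Fin n) → ∃ λ z → ∀ i → Leq P (f i) z
    bound {zero}  f = fromℕ< 0<n , λ ()
    bound {suc k} f =
      let z , f≤z   = bound (f ∘ suc)
          w , f₀≤w , z≤w = ub (f zero) z
      in w , λ { zero → f₀≤w ; (suc i) → Leq-trans (f≤z i) z≤w }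

  Covers : Fin n → Fin n → Set
  Covers x y = Lt P x y × (∀ z → Leq P x z → Leq P z y → z ≡ x ⊎ z ≡ y)

  infixr 5 _◁_

  -- A saturated chain, indexed by its length. Unlike a maximal chain given as a list, it can be
  -- concatenated and carried along an embedding one cover at a time.
  data Path : Fin n → Fin n → ℕ → Set where
    ε   : ∀ {x} → Path x x 0
    _◁_ : ∀ {x y z k} → Covers x y → Path y z k → Path x z (suc k)

  Path⇒Leq : ∀ {x y k} → Path x y k → Leq P x y
  Path⇒Leq ε                    = reflexive P _
  Path⇒Leq (((x≤y , _) , _) ◁ p) = Leq-trans x≤y (Path⇒Leq p)

  _◁◁_ : ∀ {x y z k l} → Path x y k → Path y z l → Path x z (k + l)
  ε       ◁◁ q = q
  (c ◁ p) ◁◁ q = c ◁ (p ◁◁ q)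

  -- Well-founded descent on the upper end: an element strictly between replaces `y`, and if there
  -- is none, `y` itself covers `x`.
  cover-below : ∀ {x y} → Lt P x y → ∃ λ z → Covers x z × Leq P z y
  cover-below {x} {y} x<y = go y (po-wellFounded Leq-isPartialOrder y) x<y
    where
    go : ∀ y → Acc (Lt P) y → Lt P x y → ∃ λ z → Covers x z × Leq P z y
    go y (acc rec) x<y with any? (λ w → Lt? x w ×-dec Lt? w y)
    ... | yes (w , x<w , w<y) =
      let z , x⋖z , z≤w = go w (rec w<y) x<w in z , x⋖z , Leq-trans z≤w (proj₁ w<y)
    ... | no none = y , (x<y , between) , reflexive P y
      where
      between : ∀ z → Leq P x z → Leq P z y → z ≡ x ⊎ z ≡ y
      between z x≤z z≤y with z ≟ x | z ≟ y
      ... | yes z≡x | _       = inj₁ z≡x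
      ... | no _    | yes z≡y = inj₂ z≡y
      ... | no z≢x  | no z≢y  = ⊥-elim (none (z , (x≤z , z≢x ∘ sym) , (z≤y , z≢y)))

module _ {n} (P : FinPoset n) where

  Leq⇒Path : ∀ {x y} → Leq P x y → ∃ (Path P x y)
  Leq⇒Path {x} {y} = go x (po-wellFounded (Leq-isPartialOrder (dual P)) x)
    where
    go : ∀ x → Acc (Lt (dual P)) x → Leq P x y → ∃ (Path P x y)
    go x (acc rec) x≤y with x ≟ y
    ... | yes refl = 0 , ε
    ... | no x≢y   =
      let z , x⋖z@((x≤z , x≢z) , _) , z≤y = cover-below P (x≤y , x≢y)
          k , p = go z (rec (x≤z , x≢z ∘ sym)) z≤y
      in suc k , x⋖z ◁ p

  Path-unsnoc : ∀ {x t k} → IsTop P t → Path P x t k → x ≢ t →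
                ∃ λ c → Leq P x c × IsCoatom P c
  Path-unsnoc top ε x≢t = ⊥-elim (x≢t refl)
  Path-unsnoc {t = t} top (_◁_ {y = y} ((x≤y , x≢y) , cov) p) x≢t with y ≟ t
  ... | no y≢t = let c , y≤c , cc = Path-unsnoc top p y≢t in c , Leq-trans P x≤y y≤c , cc
  ... | yes refl = _ , reflexive P _ , (λ tx → x≢t (IsTop-unique P tx top)) , coatom
    where
    coatom : ∀ z → Leq P _ z → z ≡ _ ⊎ IsTop P z
    coatom z x≤z with cov z x≤z (top z)
    ... | inj₁ z≡x  = inj₁ z≡x
    ... | inj₂ refl = inj₂ top

  Leq-coatom : ∀ {x t} → IsTop P t → ¬ IsTop P x → ∃ λ c → Leq P x c × IsCoatom P c
  Leq-coatom {x} top ¬tx = Path-unsnoc top (proj₂ (Leq⇒Path (top x))) λ { refl → ¬tx top }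

  coatom⋖top : ∀ {c t} → IsTop P t → IsCoatom P c → Covers P c t
  coatom⋖top {c} {t} top (¬tc , cov) = (top c , λ { refl → ¬tc top }) , between
    where
    between : ∀ z → Leq P c z → Leq P z t → z ≡ c ⊎ z ≡ t
    between z c≤z _ with cov z c≤z
    ... | inj₁ z≡c = inj₁ z≡c
    ... | inj₂ tz  = inj₂ (IsTop-unique P tz top)

  vertices : ∀ {x y k} → Path P x y k → List (Fin n)
  vertices {x} ε       = x ∷ []
  vertices {x} (_ ◁ p) = x ∷ vertices p

  length-vertices : ∀ {x y k} (p : Path P x y k) → length (vertices p) ≡ suc k
  length-vertices ε       = refl
  length-vertices (_ ◁ p) = cong suc (length-vertices p)

  vertices-linked : ∀ {x y k} (p : Path P x y k) → Linked (Lt P) (vertices p)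
  vertices-linked ε                   = [-]
  vertices-linked ((x<y , _) ◁ ε)     = x<y ∷ [-]
  vertices-linked ((x<y , _) ◁ q@(_ ◁ _)) = x<y ∷ vertices-linked q

  vertices-bounded : ∀ {x y k} (p : Path P x y k) → All (λ z → Leq P z y) (vertices p)
  vertices-bounded ε       = reflexive P _ ∷ []
  vertices-bounded (c ◁ p) = Path⇒Leq P (c ◁ p) ∷ vertices-bounded p

  vertices-head : ∀ {x y k} (p : Path P x y k) → x ∈ vertices p
  vertices-head ε       = here refl
  vertices-head (_ ◁ _) = here refl

  -- Walk up while the next vertex `b` is below `z`. The first `b` that is not below `z` is the
  -- incomparable witness, since `z ≤ b` would force `z` to be one end of the covering step.
  vertices-maximal : ∀ {x y k} (p : Path P x y k) → ∀ z → Leq P x z → Leq P z y →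
                     z ∉ vertices p → ∃ λ v → v ∈ vertices p × ¬ Comparable P z v
  vertices-maximal ε z x≤z z≤y z∉ = ⊥-elim (z∉ (here (Leq-antisym P z≤y x≤z)))
  vertices-maximal (_◁_ {y = b} (_ , cov) p) z x≤z z≤y z∉ with le P b z ≟ᵇ true
  ... | yes b≤z = let v , v∈ , inc = vertices-maximal p z b≤z z≤y (z∉ ∘ there)
                  in v , there v∈ , inc
  ... | no b≰z = b , there (vertices-head p) , λ
    { (inj₂ b≤z) → b≰z b≤z
    ; (inj₁ z≤b) → case-cov (cov z x≤z z≤b) }
    where
    case-cov : z ≡ _ ⊎ z ≡ b → ⊥
    case-cov (inj₁ refl) = z∉ (here refl)
    case-cov (inj₂ refl) = b≰z (reflexive P b)

  linked-bounds : ∀ {x l} → Linked (Lt P) (x ∷ l) → All (Leq P x) (x ∷ l)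
  linked-bounds [-]               = reflexive P _ ∷ []
  linked-bounds ((x≤y , _) ∷ lnk) =
    reflexive P _ ∷ All.map (Leq-trans P x≤y) (linked-bounds lnk)

  -- Maximality is asked only within the interval from `x` to `t`, so that the tail inherits it: an
  -- element above `y` is comparable with `x`, hence its incomparable witness lies in the tail.
  linked⇒Path : ∀ {x t l} → Linked (Lt P) (x ∷ l) → All (λ z → Leq P z t) (x ∷ l) →
    (∀ z → Leq P x z → Leq P z t → z ∉ x ∷ l → ∃ λ v → v ∈ x ∷ l × ¬ Comparable P z v) →
    Path P x t (length l)
  linked⇒Path {x} {t} {[]} [-] (x≤t ∷ []) mx with x ≟ t
  ... | yes refl = ε
  ... | no x≢t with mx t x≤t (reflexive P t) (λ { (here t≡x) → x≢t (sym t≡x) })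
  ...   | _ , here refl , inc = ⊥-elim (inc (inj₂ x≤t))
  linked⇒Path {x} {t} {y ∷ l} ((x≤y , x≢y) ∷ lnk) (x≤t ∷ bd@(y≤t ∷ _)) mx =
    ((x≤y , x≢y) , between) ◁ linked⇒Path lnk bd mx'
    where
    above : All (Leq P y) (y ∷ l)
    above = linked-bounds lnk

    between : ∀ z → Leq P x z → Leq P z y → z ≡ x ⊎ z ≡ y
    between z x≤z z≤y with z ≟ x | z ≟ y
    ... | yes z≡x | _       = inj₁ z≡x
    ... | no _    | yes z≡y = inj₂ z≡y
    ... | no z≢x  | no z≢y  with mx z x≤z (Leq-trans P z≤y y≤t)
                              (λ { (here z≡x) → z≢x z≡x
                                 ; (there z∈) → z≢y (Leq-antisym P z≤y (All.lookup above z∈)) })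
    ...   | _ , here refl , inc = ⊥-elim (inc (inj₂ x≤z))
    ...   | _ , there v∈  , inc = ⊥-elim (inc (inj₁ (Leq-trans P z≤y (All.lookup above v∈))))

    mx' : ∀ z → Leq P y z → Leq P z t → z ∉ y ∷ l → ∃ λ v → v ∈ y ∷ l × ¬ Comparable P z v
    mx' z y≤z z≤t z∉ with mx z (Leq-trans P x≤y y≤z) z≤t
                         (λ { (here refl) → x≢y (Leq-antisym P x≤y y≤z)
                            ; (there z∈) → z∉ z∈ })
    ... | _ , here refl , inc = ⊥-elim (inc (inj₂ (Leq-trans P x≤y y≤z)))
    ... | v , there v∈  , inc = v , v∈ , inc

  -- `S` is the down-set of `t`, given only up to logical equivalence. This covers ranks, with `S`
  -- the elements below `x`, as well as maximal chains of all of `P`, with `S` constantly `⊤` and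
  -- `t` the top.
  module _ {S : Fin n → Set} {b t : Fin n} (bot : IsBot P b) (St : S t)
           (S⇒≤ : ∀ {z} → S z → Leq P z t) (≤⇒S : ∀ {z} → Leq P z t → S z) where

    Path⇒MaxChainIn : ∀ {k} → Path P b t k → ∃ λ l → MaxChainIn P S l × length l ≡ suc k
    Path⇒MaxChainIn p =
      vertices p
      , (vertices-linked p , All.map ≤⇒S (vertices-bounded p)
        , λ z Sz → vertices-maximal p z (bot z) (S⇒≤ Sz))
      , length-vertices p

    MaxChainIn⇒Path : ∀ {l} → MaxChainIn P S l → ∃ λ k → Path P b t k × length l ≡ suc k
    MaxChainIn⇒Path {[]} (_ , _ , mx) with () ← proj₁ (proj₂ (mx t St λ ()))
    MaxChainIn⇒Path {x ∷ l} (lnk , inS , mx) with b ≟ x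
    ... | yes refl =
      _ , linked⇒Path lnk (All.map S⇒≤ inS) (λ z _ z≤t → mx z (≤⇒S z≤t)) , refl
    ... | no b≢x with mx b (≤⇒S (bot t))
                     (λ b∈ → b≢x (Leq-antisym P (bot x) (All.lookup (linked-bounds lnk) b∈)))
    ...   | _ , _ , inc = ⊥-elim (inc (inj₁ (bot _)))

  module _ {b} (bot : IsBot P b) where

    Path⇒HasRank : ∀ {x k} → Path P b x k → HasRank P x k
    Path⇒HasRank = Path⇒MaxChainIn bot (reflexive P _) (λ z≤ → z≤) (λ z≤ → z≤)

    HasRank⇒Path : ∀ {x k} → HasRank P x k → Path P b x k
    HasRank⇒Path (l , mc , len) with MaxChainIn⇒Path bot (reflexive P _) (λ z≤ → z≤) (λ z≤ → z≤) mc
    ... | k , p , len' = subst (Path P b _) (suc-injective (trans (sym len') len)) p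

    module _ {t} (top : IsTop P t) where

      MaxChain⇒Path : ∀ {l} → MaxChain P l → ∃ λ k → Path P b t k × length l ≡ suc k
      MaxChain⇒Path = MaxChainIn⇒Path bot tt (λ _ → top _) (λ _ → tt)

      module _ (graded : Graded P) where

        -- Both paths are prolonged by the same path to the top; gradedness compares the two maximal
        -- chains, and the common part cancels.
        Path-unique : ∀ {x k k'} → Path P b x k → Path P b x k' → k ≡ k'
        Path-unique {x} {k} {k'} p p' =
          let m , q         = Leq⇒Path (top x)
              l , mc , len    = Path⇒MaxChainIn bot tt (λ _ → top _) (λ _ → tt) (_◁◁_ P p q)
              l' , mc' , len' = Path⇒MaxChainIn bot tt (λ _ → top _) (λ _ → tt) (_◁◁_ P p' q)
          in +-cancelʳ-≡ m k k' (suc-injective (trans (sym len) (trans (graded l l' mc mc') len')))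

-- Embeddings and vertical 2-sums

record Bounded {n} (P : FinPoset n) : Set where
  field
    bot   : Fin n
    isBot : IsBot P bot
    top   : Fin n
    isTop : IsTop P top

open Bounded

Bounded-dual : ∀ {n} {P : FinPoset n} → Bounded P → Bounded (dual P)
Bounded-dual B = record { bot = top B ; isBot = isTop B ; top = bot B ; isTop = isBot B }

lattice⇒Bounded : ∀ {n} {P : FinPoset n} → IsLattice P → Bounded P
lattice⇒Bounded {P = P} (0<n , lat) =
  let t , top = directed⇒top P
                  (λ x y → let z , x≤z , y≤z , _ = proj₁ (lat x y) in z , x≤z , y≤z) 0<n
      b , bot = directed⇒top (dual P)
                  (λ x y → let z , z≤x , z≤y , _ = proj₂ (lat x y) in z , z≤x , z≤y) 0<n
  in record { bot = b ; isBot = bot ; top = t ; isTop = top }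

-- Agreement of the orders, with reflexivity and antisymmetry, makes `R` single-valued in both
-- directions, so the inverse laws come for free.
relation⇒Iso : ∀ {n m} (P : FinPoset n) (Q : FinPoset m) (R : Fin n → Fin m → Set) →
  (∀ x → ∃ (R x)) → (∀ y → ∃ λ x → R x y) →
  (∀ {x x' y y'} → R x y → R x' y' → le P x x' ≡ le Q y y') → Iso P Q
relation⇒Iso P Q R total onto order =
  mk↔ₛ′ (proj₁ ∘ total) (proj₁ ∘ onto)
        (λ y → functional (proj₂ (total _)) (proj₂ (onto y)))
        (λ x → injective (proj₂ (onto _)) (proj₂ (total x)))
  , λ x y → order (proj₂ (total x)) (proj₂ (total y))
  where
  functional : ∀ {x y y'} → R x y → R x y' → y ≡ y'
  functional r r' = Leq-antisym Q (trans (sym (order r r')) (reflexive P _))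
                                  (trans (sym (order r' r)) (reflexive P _))

  injective : ∀ {x x' y} → R x y → R x' y → x ≡ x'
  injective r r' = Leq-antisym P (trans (order r r') (reflexive Q _))
                                 (trans (order r' r) (reflexive Q _))

Iso-dual : ∀ {n m} {P : FinPoset n} {Q : FinPoset m} → Iso (dual P) (dual Q) → Iso P Q
Iso-dual (σ , ord) = σ , λ x y → ord y x

Iso-sym : ∀ {n m} {P : FinPoset n} {Q : FinPoset m} → Iso P Q → Iso Q P
Iso-sym {P = P} {Q} (σ , ord) =
  mk↔ₛ′ from to strictlyInverseʳ strictlyInverseˡ
  , λ x y → trans (cong₂ (le Q) (sym (strictlyInverseˡ x)) (sym (strictlyInverseˡ y)))
                  (sym (ord (from x) (from y)))
  where open Inverse σ

-- L with its top removed, embedded in S as the subset D.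
record Embedding {l s} (L : FinPoset l) (S : FinPoset s) (D : Fin s → Set) : Set₁ where
  field
    R      : Fin l → Fin s → Set
    total  : ∀ {x} → ¬ IsTop L x → ∃ (R x)
    nontop : ∀ {x u} → R x u → ¬ IsTop L x
    inside : ∀ {x u} → R x u → D u
    onto   : ∀ {u} → D u → ∃ λ x → R x u
    order  : ∀ {x y u v} → R x u → R y v → le L x y ≡ le S u v

  order⁺ : ∀ {x y u v} → R x u → R y v → Leq L x y → Leq S u v
  order⁺ r r' x≤y = trans (sym (order r r')) x≤y

  order⁻ : ∀ {x y u v} → R x u → R y v → Leq S u v → Leq L x y
  order⁻ r r' u≤v = trans (order r r') u≤v

  functional : ∀ {x u v} → R x u → R x v → u ≡ v
  functional r r' = Leq-antisym S (order⁺ r r' (reflexive L _)) (order⁺ r' r (reflexive L _))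

  injective : ∀ {x y u} → R x u → R y u → x ≡ y
  injective r r' = Leq-antisym L (order⁻ r r' (reflexive S _)) (order⁻ r' r (reflexive S _))

-- Elements of `L` and `L'` correspond when they occupy the same place in `S`; the two tops, which
-- have no place there, are matched with each other.
Embedding-unique : ∀ {l l' s} {L : FinPoset l} {L' : FinPoset l'} {S : FinPoset s}
  {D D' : Fin s → Set} → Bounded L → Bounded L' →
  Embedding L S D → Embedding L' S D' → (∀ {u} → D u → D' u) → (∀ {u} → D' u → D u) →
  Iso L L'
Embedding-unique {L = L} {L'} {S} B B' E E' D⇒D' D'⇒D = relation⇒Iso L L' R total onto order
  where
  module E = Embedding E
  module E' = Embedding E'

  R : _ → _ → Set
  R x x' = (IsTop L x × IsTop L' x') ⊎ (∃ λ u → E.R x u × E'.R x' u)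

  total : ∀ x → ∃ (R x)
  total x with IsTop? L (isTop B) x
  ... | yes tx = top B' , inj₁ (tx , isTop B')
  ... | no ¬tx =
    let u , r = E.total ¬tx
        x' , r' = E'.onto (D⇒D' (E.inside r))
    in x' , inj₂ (u , r , r')

  onto : ∀ x' → ∃ λ x → R x x'
  onto x' with IsTop? L' (isTop B') x'
  ... | yes tx' = top B , inj₁ (isTop B , tx')
  ... | no ¬tx' =
    let u , r' = E'.total ¬tx'
        x , r = E.onto (D'⇒D (E'.inside r'))
    in x , inj₂ (u , r , r')

  order : ∀ {x y x' y'} → R x x' → R y y' → le L x y ≡ le L' x' y'
  order (inj₂ (_ , rx , rx')) (inj₂ (_ , ry , ry')) = trans (E.order rx ry) (sym (E'.order rx' ry'))
  order (inj₁ _) (inj₁ (ty , ty')) = trans (ty _) (sym (ty' _))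
  order (inj₂ _) (inj₁ (ty , ty')) = trans (ty _) (sym (ty' _))
  -- Both comparisons fail: whatever lies above a top is a top, and embedded elements are not.
  order (inj₁ (tx , tx')) (inj₂ (_ , ry , ry')) = ⇔→≡ {z = true} (mk⇔
    (λ x≤y → ⊥-elim (E.nontop ry (IsTop-Leq L tx x≤y)))
    (λ x'≤y' → ⊥-elim (E'.nontop ry' (IsTop-Leq L' tx' x'≤y'))))

Embedding-Iso : ∀ {l s s'} {L : FinPoset l} {S : FinPoset s} {S' : FinPoset s'}
  {D : Fin s → Set} {D' : Fin s' → Set} ((σ , _) : Iso S S') →
  (∀ {u} → D (Inverse.from σ u) → D' u) → (∀ {u} → D' u → D (Inverse.from σ u)) →
  Embedding L S D → Embedding L S' D'
Embedding-Iso {S = S} {S'} {D} iso@(σ , _) D⇒D' D'⇒D E = record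
  { R      = λ x u → R x (from u)
  ; total  = λ ¬tx → let u , r = total ¬tx in to u , subst (R _) (sym (strictlyInverseʳ u)) r
  ; nontop = nontop
  ; inside = D⇒D' ∘ inside
  ; onto   = onto ∘ D'⇒D
  ; order  = λ r r' → trans (order r r') (sym (proj₂ (Iso-sym {P = S} {Q = S'} iso) _ _))
  }
  where
  open Embedding E
  open Inverse σ

-- As `D` is closed downwards, everything below an embedded element is embedded. Hence every notion
-- that looks only downwards (bottom, atoms, covers, ranks) agrees in `L` and `S`. The upper summand
-- uses the same module in the dual orders.
module EmbeddingProperties {l s} {L : FinPoset l} {S : FinPoset s} {D : Fin s → Set}
  (E : Embedding L S D) (D-closed : ∀ {u v} → Leq S u v → D v → D u)
  (BL : Bounded L) (BS : Bounded S) where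

  open Embedding E public

  nontop-Leq : ∀ {x y v} → Leq L x y → R y v → ¬ IsTop L x
  nontop-Leq x≤y r tx = nontop r (IsTop-Leq L tx x≤y)

  below : ∀ {v w} → Leq S v w → D w → ∃ λ x → R x v
  below v≤w Dw = onto (D-closed v≤w Dw)

  R-bot : ∀ {x u} → R x u → R (bot BL) (bot BS)
  R-bot r with total (nontop-Leq (isBot BL _) r) | below (isBot BS _) (inside r)
  ... | v , r₁ | w , r₂ = subst (R (bot BL)) v≡⊥ r₁
    where v≡⊥ = Leq-antisym S (order⁺ r₁ r₂ (isBot BL w)) (isBot BS v)

  IsBot⇒ : ∀ {x u} → R x u → IsBot L x → IsBot S u
  IsBot⇒ r bx z = Leq-trans S (order⁺ r (R-bot r) (bx _)) (isBot BS z)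

  IsBot⇐ : ∀ {x u} → R x u → IsBot S u → IsBot L x
  IsBot⇐ r bu z = Leq-trans L (order⁻ r (R-bot r) (bu _)) (isBot BL z)

  IsAtom⇒ : ∀ {x u} → R x u → IsAtom L x → IsAtom S u
  IsAtom⇒ {x} {u} r (¬bx , cov) = ¬bx ∘ IsBot⇐ r , below-atom
    where
    below-atom : ∀ z → Leq S z u → z ≡ u ⊎ IsBot S z
    below-atom z z≤u with below z≤u (inside r)
    ... | w , r' with cov w (order⁻ r' r z≤u)
    ...   | inj₁ refl = inj₁ (functional r' r)
    ...   | inj₂ bw   = inj₂ (IsBot⇒ r' bw)

  IsAtom⇐ : ∀ {x u} → R x u → IsAtom S u → IsAtom L x
  IsAtom⇐ {x} {u} r (¬bu , cov) = ¬bu ∘ IsBot⇒ r , below-atom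
    where
    below-atom : ∀ z → Leq L z x → z ≡ x ⊎ IsBot L z
    below-atom z z≤x with total (nontop-Leq z≤x r)
    ... | w , r' with cov w (order⁺ r' r z≤x)
    ...   | inj₁ refl = inj₁ (injective r' r)
    ...   | inj₂ bw   = inj₂ (IsBot⇐ r' bw)

  maximal⇒IsCoatom : ∀ {x u} → R x u → (∀ v → D v → Leq S u v → v ≡ u) → IsCoatom L x
  maximal⇒IsCoatom {x} {u} r max = nontop r , above
    where
    above : ∀ z → Leq L x z → z ≡ x ⊎ IsTop L z
    above z x≤z with IsTop? L (isTop BL) z
    ... | yes tz = inj₂ tz
    ... | no ¬tz with total ¬tz
    ...   | w , r' with max w (inside r') (order⁺ r r' x≤z)
    ...     | refl = inj₁ (injective r' r)

  Covers⇒ : ∀ {x y u v} → R x u → R y v → Covers L x y → Covers S u v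
  Covers⇒ {u = u} {v} r r' ((x≤y , x≢y) , cov) =
    (order⁺ r r' x≤y , λ { refl → x≢y (injective r r') }) , between
    where
    between : ∀ z → Leq S u z → Leq S z v → z ≡ u ⊎ z ≡ v
    between z u≤z z≤v with below z≤v (inside r')
    ... | w , r″ with cov w (order⁻ r r″ u≤z) (order⁻ r″ r' z≤v)
    ...   | inj₁ refl = inj₁ (functional r″ r)
    ...   | inj₂ refl = inj₂ (functional r″ r')

  Covers⇐ : ∀ {x y u v} → R x u → R y v → Covers S u v → Covers L x y
  Covers⇐ {x} {y} r r' ((u≤v , u≢v) , cov) =
    (order⁻ r r' u≤v , λ { refl → u≢v (functional r r') }) , between
    where
    between : ∀ z → Leq L x z → Leq L z y → z ≡ x ⊎ z ≡ y
    between z x≤z z≤y with total (nontop-Leq z≤y r')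
    ... | w , r″ with cov w (order⁺ r r″ x≤z) (order⁺ r″ r' z≤y)
    ...   | inj₁ refl = inj₁ (injective r″ r)
    ...   | inj₂ refl = inj₂ (injective r″ r')

  Path⇒ : ∀ {x y u v k} → R x u → R y v → Path L x y k → Path S u v k
  Path⇒ r r' ε with refl ← functional r r' = ε
  Path⇒ r r' (c ◁ p) with total (nontop-Leq (Path⇒Leq L p) r')
  ... | w , r″ = Covers⇒ r r″ c ◁ Path⇒ r″ r' p

  Path⇐ : ∀ {x y u v k} → R x u → R y v → Path S u v k → Path L x y k
  Path⇐ r r' ε with refl ← injective r r' = ε
  Path⇐ r r' (c ◁ p) with below (Path⇒Leq S p) (inside r')
  ... | w , r″ = Covers⇐ r r″ c ◁ Path⇐ r″ r' p

  rank⇒ : ∀ {x u k} → R x u → Path L (bot BL) x k → Path S (bot BS) u k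
  rank⇒ r = Path⇒ (R-bot r) r

  rank⇐ : ∀ {x u k} → R x u → Path S (bot BS) u k → Path L (bot BL) x k
  rank⇐ r = Path⇐ (R-bot r) r

-- Taken in `dual P`, the same formula gives the elements above `c₁` or `c₂`.
Below : ∀ {n} (P : FinPoset n) (c₁ c₂ : Fin n) → Fin n → Set
Below P c₁ c₂ x = Leq P x c₁ ⊎ Leq P x c₂

Below-closed : ∀ {n} (P : FinPoset n) {c₁ c₂ x y} → Leq P x y → Below P c₁ c₂ y → Below P c₁ c₂ x
Below-closed P x≤y = Sum.map (Leq-trans P x≤y) (Leq-trans P x≤y)

Below-maximal₁ : ∀ {n} (P : FinPoset n) {c₁ c₂} → ¬ Leq P c₁ c₂ →
                 ∀ z → Below P c₁ c₂ z → Leq P c₁ z → z ≡ c₁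
Below-maximal₁ P c₁≰c₂ z (inj₁ z≤c₁) c₁≤z = Leq-antisym P z≤c₁ c₁≤z
Below-maximal₁ P c₁≰c₂ z (inj₂ z≤c₂) c₁≤z = ⊥-elim (c₁≰c₂ (Leq-trans P c₁≤z z≤c₂))

Below-maximal₂ : ∀ {n} (P : FinPoset n) {c₁ c₂} → ¬ Leq P c₂ c₁ →
                 ∀ z → Below P c₁ c₂ z → Leq P c₂ z → z ≡ c₂
Below-maximal₂ P c₂≰c₁ z b = Below-maximal₁ P c₂≰c₁ z (Sum.swap b)

-- The intrinsic form of a vertical 2-sum: the pair c₁, c₂ of identified
-- elements splits S into a copy of L without top and a copy of U without bottom.
record Gluing {l u s} (L : FinPoset l) (U : FinPoset u) (S : FinPoset s) : Set₁ where
  field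
    c₁ c₂ : Fin s
    c₁≰c₂ : ¬ Leq S c₁ c₂
    c₂≰c₁ : ¬ Leq S c₂ c₁
    lower : Embedding L S (Below S c₁ c₂)
    upper : Embedding (dual U) (dual S) (Below (dual S) c₁ c₂)
    cover : ∀ z → Below S c₁ c₂ z ⊎ Below (dual S) c₁ c₂ z

  c₁≢c₂ : c₁ ≢ c₂
  c₁≢c₂ c₁≡c₂ = c₁≰c₂ (Leq-reflexive S c₁≡c₂)

  meet-cut : ∀ {z} → Below S c₁ c₂ z → Below (dual S) c₁ c₂ z → z ≡ c₁ ⊎ z ≡ c₂
  meet-cut b (inj₁ c₁≤z) = inj₁ (Below-maximal₁ S c₁≰c₂ _ b c₁≤z)
  meet-cut b (inj₂ c₂≤z) = inj₂ (Below-maximal₂ S c₂≰c₁ _ b c₂≤z)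

Gluing-Iso : ∀ {l u s s'} {L : FinPoset l} {U : FinPoset u} {S : FinPoset s} {S' : FinPoset s'} →
             Iso S S' → Gluing L U S → Gluing L U S'
Gluing-Iso {S = S} {S'} iso@(σ , ord) G = record
  { c₁    = to c₁
  ; c₂    = to c₂
  ; c₁≰c₂ = λ h → c₁≰c₂ (trans (ord _ _) h)
  ; c₂≰c₁ = λ h → c₂≰c₁ (trans (ord _ _) h)
  ; lower = Embedding-Iso iso (Sum.map to-Leq to-Leq) (Sum.map from-Leq from-Leq) lower
  ; upper = Embedding-Iso {S = dual S} {S' = dual S'} (σ , λ x y → ord y x)
              (Sum.map to-Geq to-Geq) (Sum.map from-Geq from-Geq) upper
  ; cover = λ z → Sum.map (Sum.map to-Leq to-Leq) (Sum.map to-Geq to-Geq) (cover (from z))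
  }
  where
  open Gluing G
  open Inverse σ

  to-Leq : ∀ {x y} → Leq S (from x) y → Leq S' x (to y)
  to-Leq {x} h = subst (λ z → Leq S' z _) (strictlyInverseˡ x) (trans (sym (ord _ _)) h)

  from-Leq : ∀ {x y} → Leq S' x (to y) → Leq S (from x) y
  from-Leq {x} h = trans (ord _ _) (subst (λ z → Leq S' z _) (sym (strictlyInverseˡ x)) h)

  to-Geq : ∀ {x y} → Leq S y (from x) → Leq S' (to y) x
  to-Geq {x} h = subst (Leq S' _) (strictlyInverseˡ x) (trans (sym (ord _ _)) h)

  from-Geq : ∀ {x y} → Leq S' (to y) x → Leq S y (from x)
  from-Geq {x} h = trans (ord _ _) (subst (Leq S' _) (sym (strictlyInverseˡ x)) h)

module _ {l u s} {L : FinPoset l} {U : FinPoset u} {S : FinPoset s} where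

  -- The images of the two coatoms of `L` form the cut. The difficulty is the transitive closure: it
  -- must be shown to add no relation inside either copy, which is done by describing all elements
  -- reachable from a given one.
  vertical2Sum⇒Gluing : Bounded L → Bounded U →
    ExactlyTwo L (IsCoatom L) → IsVertical2Sum L U S → Gluing L U S
  vertical2Sum⇒Gluing BL BU (a₁ , a₂ , a₁≢a₂ , ca₁ , ca₂ , only)
    (π , π-onto , α-inj , β-inj , glued , coatom-glued , atom-glued , closure) = record
      { c₁    = c₁
      ; c₂    = c₂
      ; c₁≰c₂ = λ h → coatoms-incomparable ca₁ ca₂ a₁≢a₂ (α-reflects h)
      ; c₂≰c₁ = λ h → coatoms-incomparable ca₂ ca₁ (a₁≢a₂ ∘ sym) (α-reflects h)
      ; lower = record
          { R      = λ x z → Σ (¬ IsTop L x) λ ¬tx → α (x , ¬tx) ≡ z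
          ; total  = λ ¬tx → _ , ¬tx , refl
          ; nontop = proj₁
          ; inside = λ { {x} (¬tx , refl) → α-below (x , ¬tx) }
          ; onto   = λ { (inj₁ z≤c₁) → lower-onto ca₁ z≤c₁ ; (inj₂ z≤c₂) → lower-onto ca₂ z≤c₂ }
          ; order  = λ { (_ , refl) (_ , refl) → ⇔→≡ {z = true} (mk⇔ α-preserves α-reflects) }
          }
      ; upper = record
          { R      = λ y z → Σ (¬ IsBot U y) λ ¬by → β (y , ¬by) ≡ z
          ; total  = λ ¬by → _ , ¬by , refl
          ; nontop = proj₁
          ; inside = λ { {y} (¬by , refl) → β-above (y , ¬by) }
          ; onto   = λ { (inj₁ c₁≤z) → upper-onto ca₁ c₁≤z ; (inj₂ c₂≤z) → upper-onto ca₂ c₂≤z }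
          ; order  = λ { (_ , refl) (_ , refl) → ⇔→≡ {z = true} (mk⇔ β-preserves β-reflects) }
          }
      ; cover = cover
      }
    where
    α : L⁻ L U S → Fin s
    α = π ∘ inj₁

    β : U⁻ L U S → Fin s
    β = π ∘ inj₂

    c₁ c₂ : Fin s
    c₁ = α (a₁ , proj₁ ca₁)
    c₂ = α (a₂ , proj₁ ca₂)

    α-preserves : ∀ {a a'} → Leq L (proj₁ a) (proj₁ a') → Leq S (α a) (α a')
    α-preserves a≤a' = proj₂ (closure _ _) [ inj₁ (_ , _ , refl , refl , a≤a') ]

    β-preserves : ∀ {b b'} → Leq U (proj₁ b) (proj₁ b') → Leq S (β b) (β b')
    β-preserves b≤b' = proj₂ (closure _ _) [ inj₂ (_ , _ , refl , refl , b≤b') ]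

    -- An element of `L⁻` contains a proof of not being the top; antisymmetry in `S` shows that `π`
    -- ignores which proof it is.
    α-cong : ∀ {a a'} → proj₁ a ≡ proj₁ a' → α a ≡ α a'
    α-cong eq = Leq-antisym S (α-preserves (Leq-reflexive L eq))
                              (α-preserves (Leq-reflexive L (sym eq)))

    β-cong : ∀ {b b'} → proj₁ b ≡ proj₁ b' → β b ≡ β b'
    β-cong eq = Leq-antisym S (β-preserves (Leq-reflexive U eq))
                              (β-preserves (Leq-reflexive U (sym eq)))

    Up-β : U⁻ L U S → Fin s → Set
    Up-β b z = Σ (U⁻ L U S) λ b' → β b' ≡ z × Leq U (proj₁ b) (proj₁ b')

    -- Normal form of a chain of union steps from the copy of `L`: it stays there, or crosses over
    -- once, at a glued pair, and then stays in the copy of `U`.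
    Up-α : L⁻ L U S → Fin s → Set
    Up-α a z =
      (Σ (L⁻ L U S) λ a' → α a' ≡ z × Leq L (proj₁ a) (proj₁ a'))
      ⊎ (Σ (L⁻ L U S) λ c → Σ (U⁻ L U S) λ d → α c ≡ β d × Leq L (proj₁ a) (proj₁ c) × Up-β d z)

    step-β : ∀ {b y z} → Up-β b y → UnionRel L U S π y z → Up-β b z
    step-β (b' , eq , b≤b') (inj₂ (b₁ , b₂ , eq₁ , eq₂ , b₁≤b₂)) =
      b₂ , eq₂ , Leq-trans U b≤b'
                   (Leq-trans U (Leq-reflexive U (β-inj b' b₁ (trans eq (sym eq₁)))) b₁≤b₂)
    -- A step of `L` from inside the copy of `U` starts at a glued element, thus at a coatom of `L`;
    -- above it is only the removed top, so the step stands still.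
    step-β (b' , eq , b≤b') (inj₁ (a₁ , a₂ , eq₁ , eq₂ , a₁≤a₂))
      with proj₂ (proj₁ (glued a₁ b' (trans eq₁ (sym eq)))) (proj₁ a₂) a₁≤a₂
    ... | inj₁ a₂≡a₁ = b' , trans eq (trans (sym eq₁) (trans (α-cong (sym a₂≡a₁)) eq₂)) , b≤b'
    ... | inj₂ ta₂   = ⊥-elim (proj₂ a₂ ta₂)

    step-α : ∀ {a y z} → Up-α a y → UnionRel L U S π y z → Up-α a z
    step-α (inj₁ (a' , eq , a≤a')) (inj₁ (a₁ , a₂ , eq₁ , eq₂ , a₁≤a₂)) =
      inj₁ (a₂ , eq₂ , Leq-trans L a≤a'
                         (Leq-trans L (Leq-reflexive L (α-inj a' a₁ (trans eq (sym eq₁)))) a₁≤a₂))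
    step-α (inj₁ (a' , eq , a≤a')) (inj₂ (b₁ , b₂ , eq₁ , eq₂ , b₁≤b₂)) =
      inj₂ (a' , b₁ , trans eq (sym eq₁) , a≤a' , b₂ , eq₂ , b₁≤b₂)
    step-α (inj₂ (c , d , eq , a≤c , up)) r = inj₂ (c , d , eq , a≤c , step-β {d} up r)

    iterate : (Q : Fin s → Set) → (∀ {y z} → Q y → UnionRel L U S π y z → Q z) →
              ∀ {y z} → Q y → TransClosure (UnionRel L U S π) y z → Q z
    iterate Q step q [ r ]    = step q r
    iterate Q step q (r ∷ rs) = iterate Q step (step q r) rs

    up-α : ∀ {a z} → Leq S (α a) z → Up-α a z
    up-α {a} h = iterate (Up-α a) (step-α {a}) (inj₁ (a , refl , reflexive L _)) (proj₁ (closure _ _) h)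

    up-β : ∀ {b z} → Leq S (β b) z → Up-β b z
    up-β {b} h = iterate (Up-β b) (step-β {b}) (b , refl , reflexive U _) (proj₁ (closure _ _) h)

    β-reflects : ∀ {b b'} → Leq S (β b) (β b') → Leq U (proj₁ b) (proj₁ b')
    β-reflects {b} {b'} h =
      let b″ , eq , b≤b″ = up-β h in Leq-trans U b≤b″ (Leq-reflexive U (β-inj b″ b' eq))

    α-reflects : ∀ {a a'} → Leq S (α a) (α a') → Leq L (proj₁ a) (proj₁ a')
    α-reflects {a} {a'} h with up-α h
    ... | inj₁ (a″ , eq , a≤a″) = Leq-trans L a≤a″ (Leq-reflexive L (α-inj a″ a' eq))
    -- A crossing chain that ends in the copy of `L` ends at a glued element, whose partner `b` is
    -- an atom of `U`. As `d` is below `b` and not the bottom, `d` is `b`, and the end point is `c`.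
    ... | inj₂ (c , d , eq , a≤c , b , eq' , d≤b)
      with proj₂ (proj₂ (glued a' b (sym eq'))) (proj₁ d) d≤b
    ...   | inj₁ d≡b = Leq-trans L a≤c
                         (Leq-reflexive L (α-inj c a' (trans eq (trans (β-cong d≡b) eq'))))
    ...   | inj₂ bd  = ⊥-elim (proj₂ d bd)

    coatoms-incomparable : ∀ {x y} → IsCoatom L x → IsCoatom L y → x ≢ y → ¬ Leq L x y
    coatoms-incomparable (_ , cov) (¬ty , _) x≢y x≤y with cov _ x≤y
    ... | inj₁ y≡x = x≢y (sym y≡x)
    ... | inj₂ ty  = ¬ty ty

    coatom-cut : ∀ a → IsCoatom L (proj₁ a) → α a ≡ c₁ ⊎ α a ≡ c₂
    coatom-cut a ca = Sum.map α-cong α-cong (only _ ca)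

    α-below : ∀ a → Below S c₁ c₂ (α a)
    α-below a with Leq-coatom L (isTop BL) (proj₂ a)
    ... | c , a≤c , cc = Sum.map below below (coatom-cut (c , proj₁ cc) cc)
      where
      below : ∀ {z} → α (c , proj₁ cc) ≡ z → Leq S (α a) z
      below refl = α-preserves a≤c

    β-above : ∀ b → Below (dual S) c₁ c₂ (β b)
    β-above b with Leq-coatom (dual U) (isBot BU) (proj₂ b)
    ... | d , d≤b , ad with atom-glued (d , proj₁ ad) ad
    ...   | a , eq = Sum.map above above (coatom-cut a (proj₁ (glued _ _ eq)))
      where
      above : ∀ {z} → α a ≡ z → Leq S z (β b)
      above refl = subst (λ y → Leq S y (β b)) (sym eq) (β-preserves d≤b)

    lower-onto : ∀ {x z} (cx : IsCoatom L x) → Leq S z (α (x , proj₁ cx)) →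
                 ∃ λ y → Σ (¬ IsTop L y) λ ¬ty → α (y , ¬ty) ≡ z
    lower-onto {x} {z} cx z≤x with π-onto z
    ... | inj₁ (y , ¬ty) , eq = y , ¬ty , eq
    ... | inj₂ b , refl with coatom-glued (x , proj₁ cx) cx
    ...   | d , eq with proj₂ (proj₂ (glued _ d eq)) (proj₁ b)
                         (β-reflects (subst (Leq S (β b)) eq z≤x))
    ...     | inj₁ b≡d = x , proj₁ cx , trans eq (β-cong (sym b≡d))
    ...     | inj₂ bb  = ⊥-elim (proj₂ b bb)

    upper-onto : ∀ {x z} (cx : IsCoatom L x) → Leq S (α (x , proj₁ cx)) z →
                 ∃ λ y → Σ (¬ IsBot U y) λ ¬by → β (y , ¬by) ≡ z
    upper-onto {x} {z} cx x≤z with π-onto z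
    ... | inj₂ (y , ¬by) , eq = y , ¬by , eq
    ... | inj₁ a , refl with proj₂ cx (proj₁ a) (α-reflects x≤z)
    ...   | inj₂ ta = ⊥-elim (proj₂ a ta)
    ...   | inj₁ a≡x with coatom-glued (x , proj₁ cx) cx
    ...     | (y , ¬by) , eq = y , ¬by , trans (sym eq) (α-cong (sym a≡x))

    cover : ∀ z → Below S c₁ c₂ z ⊎ Below (dual S) c₁ c₂ z
    cover z with π-onto z
    ... | inj₁ a , refl = inj₁ (α-below a)
    ... | inj₂ b , refl = inj₂ (β-above b)

-- The number of elements of a gluing

relation⇒≤ : ∀ {a b c d} (T : Fin a ⊎ Fin b → Fin c ⊎ Fin d → Set) →
             (∀ x → ∃ (T x)) → (∀ {x x' y} → T x y → T x' y → x ≡ x') → a + b ≤ c + d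
relation⇒≤ {a} {b} {c} {d} T total inj = injective⇒≤ f-injective
  where
  g : ∀ i → ∃ (T (splitAt a i))
  g i = total (splitAt a i)

  f : Fin (a + b) → Fin (c + d)
  f i = join c d (proj₁ (g i))

  f-injective : ∀ {i j} → f i ≡ f j → i ≡ j
  f-injective {i} {j} eq =
    trans (sym (join-splitAt a b i)) (trans (cong (join a b) same) (join-splitAt a b j))
    where
    image : proj₁ (g i) ≡ proj₁ (g j)
    image = trans (sym (splitAt-join c d _)) (trans (cong (splitAt c) eq) (splitAt-join c d _))

    same : splitAt a i ≡ splitAt a j
    same = inj (subst (T (splitAt a i)) image (proj₂ (g i))) (proj₂ (g j))

module _ {l u s} {L : FinPoset l} {U : FinPoset u} {S : FinPoset s}
         (G : Gluing L U S) (BL : Bounded L) (BU : Bounded U) where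

  open Gluing G
  private
    module Lo = Embedding lower
    module Up = Embedding upper

  -- L ⊎ U corresponds to S together with four more elements: the top of L, the
  -- bottom of U, and second copies of c₁ and c₂.
  data Slot : Fin l ⊎ Fin u → Fin s ⊎ Fin 4 → Set where
    low  : ∀ {x z} → Lo.R x z → Slot (inj₁ x) (inj₁ z)
    topL : ∀ {x} → IsTop L x → Slot (inj₁ x) (inj₂ zero)
    high : ∀ {y z} → Up.R y z → ¬ Below S c₁ c₂ z → Slot (inj₂ y) (inj₁ z)
    botU : ∀ {y} → IsBot U y → Slot (inj₂ y) (inj₂ (suc zero))
    cut₁ : ∀ {y} → Up.R y c₁ → Slot (inj₂ y) (inj₂ (suc (suc zero)))
    cut₂ : ∀ {y} → Up.R y c₂ → Slot (inj₂ y) (inj₂ (suc (suc (suc zero))))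

  Below? : ∀ z → Dec (Below S c₁ c₂ z)
  Below? z = (le S z c₁ ≟ᵇ true) ⊎-dec (le S z c₂ ≟ᵇ true)

  Slot-total : ∀ x → ∃ (Slot x)
  Slot-total (inj₁ x) with IsTop? L (isTop BL) x
  ... | yes tx = _ , topL tx
  ... | no ¬tx = _ , low (proj₂ (Lo.total ¬tx))
  Slot-total (inj₂ y) with IsTop? (dual U) (isBot BU) y
  ... | yes by = _ , botU by
  ... | no ¬by with Up.total ¬by
  ...   | z , r with Below? z
  ...     | no ¬below = _ , high r ¬below
  ...     | yes below with meet-cut below (Up.inside r)
  ...       | inj₁ refl = _ , cut₁ r
  ...       | inj₂ refl = _ , cut₂ r

  Slot-onto : ∀ z → ∃ λ x → Slot x z
  Slot-onto (inj₁ z) with Below? z | cover z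
  ... | yes below | _          = _ , low (proj₂ (Lo.onto below))
  ... | no ¬below | inj₁ below = ⊥-elim (¬below below)
  ... | no ¬below | inj₂ above = _ , high (proj₂ (Up.onto above)) ¬below
  Slot-onto (inj₂ zero)                   = _ , topL (isTop BL)
  Slot-onto (inj₂ (suc zero))             = _ , botU (isBot BU)
  Slot-onto (inj₂ (suc (suc zero)))       = _ , cut₁ (proj₂ (Up.onto (inj₁ (reflexive S c₁))))
  Slot-onto (inj₂ (suc (suc (suc zero)))) = _ , cut₂ (proj₂ (Up.onto (inj₂ (reflexive S c₂))))

  Slot-injective : ∀ {x x' z} → Slot x z → Slot x' z → x ≡ x'
  Slot-injective (low r)    (low r')    = cong inj₁ (Lo.injective r r')
  Slot-injective (low r)    (high _ ¬b) = ⊥-elim (¬b (Lo.inside r))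
  Slot-injective (high _ ¬b) (low r)    = ⊥-elim (¬b (Lo.inside r))
  Slot-injective (high r _) (high r' _) = cong inj₂ (Up.injective r r')
  Slot-injective (topL t)    (topL t')    = cong inj₁ (IsTop-unique L t t')
  Slot-injective (botU b)    (botU b')    = cong inj₂ (IsTop-unique (dual U) b b')
  Slot-injective (cut₁ r)   (cut₁ r')   = cong inj₂ (Up.injective r r')
  Slot-injective (cut₂ r)   (cut₂ r')   = cong inj₂ (Up.injective r r')

  Slot-functional : ∀ {x z z'} → Slot x z → Slot x z' → z ≡ z'
  Slot-functional (low r)    (low r')    = cong inj₁ (Lo.functional r r')
  Slot-functional (low r)    (topL t)     = ⊥-elim (Lo.nontop r t)
  Slot-functional (topL t)    (low r)     = ⊥-elim (Lo.nontop r t)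
  Slot-functional (topL _)    (topL _)     = refl
  Slot-functional (high r _) (high r' _) = cong inj₁ (Up.functional r r')
  Slot-functional (high r _) (botU b)     = ⊥-elim (Up.nontop r b)
  Slot-functional (high r ¬b) (cut₁ r')  =
    ⊥-elim (¬b (inj₁ (Leq-reflexive S (Up.functional r r'))))
  Slot-functional (high r ¬b) (cut₂ r')  =
    ⊥-elim (¬b (inj₂ (Leq-reflexive S (Up.functional r r'))))
  Slot-functional (botU b)    (high r _)  = ⊥-elim (Up.nontop r b)
  Slot-functional (botU b)    (botU _)     = refl
  Slot-functional (botU b)    (cut₁ r)    = ⊥-elim (Up.nontop r b)
  Slot-functional (botU b)    (cut₂ r)    = ⊥-elim (Up.nontop r b)
  Slot-functional (cut₁ r')  (high r ¬b) =
    ⊥-elim (¬b (inj₁ (Leq-reflexive S (Up.functional r r'))))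
  Slot-functional (cut₁ r)   (botU b)     = ⊥-elim (Up.nontop r b)
  Slot-functional (cut₁ _)   (cut₁ _)    = refl
  Slot-functional (cut₁ r)   (cut₂ r')   = ⊥-elim (c₁≢c₂ (Up.functional r r'))
  Slot-functional (cut₂ r')  (high r ¬b) =
    ⊥-elim (¬b (inj₂ (Leq-reflexive S (Up.functional r r'))))
  Slot-functional (cut₂ r)   (botU b)     = ⊥-elim (Up.nontop r b)
  Slot-functional (cut₂ r)   (cut₁ r')   = ⊥-elim (c₁≢c₂ (Up.functional r' r))
  Slot-functional (cut₂ _)   (cut₂ _)    = refl

  -- Closure of the family leaves the size of the sum open; this equation determines it. `Slot` is
  -- read as an injection in each direction.
  Gluing-size : s + 4 ≡ l + u
  Gluing-size = ≤-antisym (relation⇒≤ (λ z x → Slot x z) Slot-onto Slot-functional)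
                          (relation⇒≤ Slot Slot-total Slot-injective)

-- Necks and uniqueness of the decomposition

-- A trace of rank at least three that mentions no chains: it keeps the glued elements from being
-- atoms or coatoms of the sum, and it is inherited by the sum.
AtomsBelowCoatoms : ∀ {n} → FinPoset n → Set
AtomsBelowCoatoms P = ∀ x → IsAtom P x → ¬ IsCoatom P x

-- An atom that is a coatom would give a covering path of length two from bottom to top, against a
-- maximal chain with at least four elements.
rank≥3⇒AtomsBelowCoatoms : ∀ {n} (P : FinPoset n) → Bounded P → Graded P → RankAtLeast3 P →
                           AtomsBelowCoatoms P
rank≥3⇒AtomsBelowCoatoms P B graded (l , mc , 4≤len) x ax cx
  with MaxChain⇒Path P (isBot B) (isTop B) mc
... | k , p , len with Path-unique P (isBot B) (isTop B) graded p
  (bot⋖atom ◁ coatom⋖top P (isTop B) cx ◁ ε)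
  where
  bot⋖atom : Covers P (bot B) x
  bot⋖atom with coatom⋖top (dual P) (isBot B) ax
  ... | (b≤x , x≢b) , cov = (b≤x , x≢b ∘ sym) , λ z b≤z z≤x → Sum.swap (cov z z≤x b≤z)
... | refl = <⇒≱ 4≤len (subst (_≤ 3) (sym len) (s≤s (s≤s (s≤s z≤n))))

record Thick {n} (P : FinPoset n) : Set where
  field
    bounded           : Bounded P
    graded            : Graded P
    atomsBelowCoatoms : AtomsBelowCoatoms P

module Cut {l u s} {L : FinPoset l} {U : FinPoset u} {S : FinPoset s} (G : Gluing L U S)
  (thickL : Thick L) (thickU : Thick U) (BS : Bounded S) (gradedS : Graded S) where

  open Thick thickL using ()
    renaming (bounded to BL; graded to gradedL; atomsBelowCoatoms to abcL)
  open Thick thickU using () renaming (bounded to BU; atomsBelowCoatoms to abcU)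
  open Gluing G public
  module Lo = EmbeddingProperties lower (Below-closed S) BL BS
  module Up = EmbeddingProperties upper (Below-closed (dual S)) (Bounded-dual BU) (Bounded-dual BS)

  OnCut : Fin s → Set
  OnCut z = z ≡ c₁ ⊎ z ≡ c₂

  onCut-coatom : ∀ {z} → OnCut z → ∃ λ a → Lo.R a z × IsCoatom L a
  onCut-coatom (inj₁ refl) =
    let a , r = Lo.onto (inj₁ (reflexive S c₁))
    in a , r , Lo.maximal⇒IsCoatom r (Below-maximal₁ S c₁≰c₂)
  onCut-coatom (inj₂ refl) =
    let a , r = Lo.onto (inj₂ (reflexive S c₂))
    in a , r , Lo.maximal⇒IsCoatom r (Below-maximal₂ S c₂≰c₁)

  onCut-atom : ∀ {z} → OnCut z → ∃ λ b → Up.R b z × IsAtom U b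
  onCut-atom (inj₁ refl) =
    let b , r = Up.onto (inj₁ (reflexive S c₁))
    in b , r , Up.maximal⇒IsCoatom r (Below-maximal₁ (dual S) c₂≰c₁)
  onCut-atom (inj₂ refl) =
    let b , r = Up.onto (inj₂ (reflexive S c₂))
    in b , r , Up.maximal⇒IsCoatom r (Below-maximal₂ (dual S) c₁≰c₂)

  coatom-onCut : ∀ {a z} → Lo.R a z → IsCoatom L a → OnCut z
  coatom-onCut {a} {z} r (_ , cov) =
    Sum.map (maximal (inj₁ refl)) (maximal (inj₂ refl)) (Lo.inside r)
    where
    maximal : ∀ {c} → OnCut c → Leq S z c → z ≡ c
    maximal cut z≤c with onCut-coatom cut
    ... | b , r' , ¬tb , _ with cov b (Lo.order⁻ r r' z≤c)
    ...   | inj₁ refl = Lo.functional r r'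
    ...   | inj₂ tb   = ⊥-elim (¬tb tb)

  onCut-¬atom : ∀ {z} → OnCut z → ¬ IsAtom S z
  onCut-¬atom cut az = let a , r , ca = onCut-coatom cut in abcL a (Lo.IsAtom⇐ r az) ca

  onCut-¬coatom : ∀ {z} → OnCut z → ¬ IsCoatom S z
  onCut-¬coatom cut cz = let b , r , ab = onCut-atom cut in abcU b ab (Up.IsAtom⇐ r cz)

  Rank : Fin s → ℕ → Set
  Rank = Path S (bot BS)

  rank-unique : ∀ {z k k'} → Rank z k → Rank z k' → k ≡ k'
  rank-unique = Path-unique S (isBot BS) (isTop BS) gradedS

  -- Both elements are coatoms of `L`, so one further step from each reaches the top of `L`, where
  -- gradedness of `L` compares the lengths.
  onCut-rank-≡ : ∀ {y z j k} → OnCut y → OnCut z → Rank y j → Rank z k → j ≡ k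
  onCut-rank-≡ {j = j} {k} cy cz p q =
    let a , r , ca = onCut-coatom cy
        b , r' , cb = onCut-coatom cz
    in suc-injective (trans (+-comm 1 j) (trans
         (Path-unique L (isBot BL) (isTop BL) gradedL
           (_◁◁_ L (Lo.rank⇐ r p) (coatom⋖top L (isTop BL) ca ◁ ε))
           (_◁◁_ L (Lo.rank⇐ r' q) (coatom⋖top L (isTop BL) cb ◁ ε)))
         (+-comm k 1)))

  ρ : ℕ
  ρ = proj₁ (Leq⇒Path S (isBot BS c₁))

  onCut-rank : ∀ {z} → OnCut z → Rank z ρ
  onCut-rank {z} cz with Leq⇒Path S (isBot BS z)
  ... | k , p = subst (Rank z) (onCut-rank-≡ cz (inj₁ refl) p (proj₂ (Leq⇒Path S (isBot BS c₁)))) p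

  between-same-rank : ∀ {x y k} → Rank x k → Rank y k → Leq S x y → x ≡ y
  between-same-rank {k = k} p q x≤y with Leq⇒Path S x≤y
  ... | zero  , ε = refl
  ... | suc j , r = ⊥-elim (m≢1+m+n k (trans (rank-unique q (_◁◁_ S p r)) (+-suc k j)))

  -- Every element of `S` is comparable with a cut element, and comparable elements of equal rank
  -- coincide.
  rank-onCut : ∀ {z} → Rank z ρ → OnCut z
  rank-onCut p with cover _
  ... | inj₁ (inj₁ z≤c₁) = inj₁ (between-same-rank p (onCut-rank (inj₁ refl)) z≤c₁)
  ... | inj₁ (inj₂ z≤c₂) = inj₂ (between-same-rank p (onCut-rank (inj₂ refl)) z≤c₂)
  ... | inj₂ (inj₁ c₁≤z) = inj₁ (sym (between-same-rank (onCut-rank (inj₁ refl)) p c₁≤z))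
  ... | inj₂ (inj₂ c₂≤z) = inj₂ (sym (between-same-rank (onCut-rank (inj₂ refl)) p c₂≤z))

  small-rank-below : ∀ {z k} → Rank z k → k < ρ → Below S c₁ c₂ z
  small-rank-below {z} {k} p k<ρ with cover z
  ... | inj₁ below = below
  ... | inj₂ above = ⊥-elim ([ absurd (inj₁ refl) , absurd (inj₂ refl) ]′ above)
    where
    absurd : ∀ {c} → OnCut c → Leq S c z → ⊥
    absurd cut c≤z = let j , q = Leq⇒Path S c≤z in
      <⇒≱ k<ρ (subst (ρ ≤_) (rank-unique (_◁◁_ S (onCut-rank cut) q) p) (m≤m+n ρ j))

  hasNeck : HasNeck S
  hasNeck = c₁ , c₂ , ρ , c₁≢c₂
    , Path⇒HasRank S (isBot BS) (onCut-rank (inj₁ refl))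
    , Path⇒HasRank S (isBot BS) (onCut-rank (inj₂ refl))
    , (λ z → rank-onCut ∘ HasRank⇒Path S (isBot BS))
    , onCut-¬atom (inj₁ refl) , onCut-¬atom (inj₂ refl)
    , onCut-¬coatom (inj₁ refl) , onCut-¬coatom (inj₂ refl)

  above-atom-onCut : ∀ {z} → Below (dual S) c₁ c₂ z → IsAtom S z → OnCut z
  above-atom-onCut (inj₁ c₁≤z) (_ , cov) with cov c₁ c₁≤z
  ... | inj₁ c₁≡z = inj₁ (sym c₁≡z)
  ... | inj₂ bc₁  = ⊥-elim (c₁≰c₂ (bc₁ c₂))
  above-atom-onCut (inj₂ c₂≤z) (_ , cov) with cov c₂ c₂≤z
  ... | inj₁ c₂≡z = inj₂ (sym c₂≡z)
  ... | inj₂ bc₂  = ⊥-elim (c₂≰c₁ (bc₂ c₁))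

  atom-below : ∀ {z} → IsAtom S z → ∃ λ x → Lo.R x z × IsAtom L x
  atom-below {z} az with cover z
  ... | inj₁ below = let x , r = Lo.onto below in x , r , Lo.IsAtom⇐ r az
  ... | inj₂ above = ⊥-elim (onCut-¬atom (above-atom-onCut above az) az)

  -- An atom above the cut, or a coatom below it, must lie on it; and no cut element is an atom.
  atomsBelowCoatoms : AtomsBelowCoatoms S
  atomsBelowCoatoms z az cz@(_ , cov) with cover z
  ... | inj₂ above = onCut-¬atom (above-atom-onCut above az) az
  ... | inj₁ (inj₁ z≤c₁) with cov c₁ z≤c₁
  ...   | inj₁ refl = onCut-¬atom (inj₁ refl) az
  ...   | inj₂ tc₁  = c₂≰c₁ (tc₁ c₂)
  atomsBelowCoatoms z az cz@(_ , cov) | inj₁ (inj₂ z≤c₂) with cov c₂ z≤c₂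
  ...   | inj₁ refl = onCut-¬atom (inj₂ refl) az
  ...   | inj₂ tc₂  = c₁≰c₂ (tc₂ c₁)

  twoAtoms : ExactlyTwo L (IsAtom L) → ExactlyTwo S (IsAtom S)
  twoAtoms (a , b , a≢b , aa , ab , only) =
    let u , r  = Lo.total (atom-nontop aa)
        v , r' = Lo.total (atom-nontop ab)
    in u , v , (λ u≡v → a≢b (Lo.injective r (subst (Lo.R b) (sym u≡v) r')))
       , Lo.IsAtom⇒ r aa , Lo.IsAtom⇒ r' ab
       , λ z az → let x , r″ , ax = atom-below az in
           Sum.map (image r r″) (image r' r″) (only x ax)
    where
    image : ∀ {x y u z} → Lo.R x u → Lo.R y z → y ≡ x → z ≡ u
    image r r' refl = Lo.functional r' r

    -- Were an atom the top, both `a` and `b` would lie below it and hence equal it.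
    atom-nontop : ∀ {x} → IsAtom L x → ¬ IsTop L x
    atom-nontop {x} (_ , cov) tx with cov a (tx a) | cov b (tx b)
    ... | inj₂ ba   | _         = proj₁ aa ba
    ... | _         | inj₂ bb   = proj₁ ab bb
    ... | inj₁ refl | inj₁ refl = a≢b refl

module _ {l u l' u' s} {L : FinPoset l} {U : FinPoset u} {L' : FinPoset l'} {U' : FinPoset u'}
  {S : FinPoset s} (G : Gluing L U S) (G' : Gluing L' U' S)
  (thickL : Thick L) (thickU : Thick U) (thickL' : Thick L') (thickU' : Thick U')
  (BS : Bounded S) (gradedS : Graded S) where

  open Thick thickL' using () renaming (bounded to BL'; graded to gradedL')

  private
    module C  = Cut G thickL thickU BS gradedS
    module C' = Cut G' thickL' thickU' BS gradedS

  -- Below rank `C'.ρ` all of `S` belongs to the copy of `L'` and keeps its rank there, so the lower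
  -- cut is a full level of `L'`. Its elements are not coatoms of `L'`, because those lie on the
  -- higher cut.
  lower-cut⇒neck : C.ρ < C'.ρ → HasNeck L'
  lower-cut⇒neck ρ<ρ' =
    let d₁ , r₁ = onto (inj₁ refl)
        d₂ , r₂ = onto (inj₂ refl)
        p₁ = C'.Lo.rank⇐ r₁ (C.onCut-rank (inj₁ refl))
        p₂ = C'.Lo.rank⇐ r₂ (C.onCut-rank (inj₂ refl))
    in d₁ , d₂ , C.ρ , (λ d₁≡d₂ → C.c₁≢c₂ (image r₁ r₂ d₁≡d₂))
       , Path⇒HasRank L' (isBot BL') p₁
       , Path⇒HasRank L' (isBot BL') p₂
       , (λ z hr → unique r₁ r₂ z (HasRank⇒Path L' (isBot BL') hr))
       , C.onCut-¬atom (inj₁ refl) ∘ C'.Lo.IsAtom⇒ r₁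
       , C.onCut-¬atom (inj₂ refl) ∘ C'.Lo.IsAtom⇒ r₂
       , ¬coatom (inj₁ refl) r₁ , ¬coatom (inj₂ refl) r₂
    where
    image : ∀ {x y u v} → C'.Lo.R x u → C'.Lo.R y v → x ≡ y → u ≡ v
    image r r' refl = C'.Lo.functional r r'

    preimage : ∀ {x y u v} → C'.Lo.R x u → C'.Lo.R y v → u ≡ v → x ≡ y
    preimage r r' refl = C'.Lo.injective r r'

    onto : ∀ {c} → C.OnCut c → ∃ λ d → C'.Lo.R d c
    onto cut = C'.Lo.onto (C'.small-rank-below (C.onCut-rank cut) ρ<ρ')

    ¬coatom : ∀ {c d} → C.OnCut c → C'.Lo.R d c → ¬ IsCoatom L' d
    ¬coatom cut r cd =
      <⇒≢ ρ<ρ' (C.rank-unique (C.onCut-rank cut) (C'.onCut-rank (C'.coatom-onCut r cd)))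

    unique : ∀ {d₁ d₂} → C'.Lo.R d₁ C.c₁ → C'.Lo.R d₂ C.c₂ →
             ∀ z → Path L' (bot BL') z C.ρ → z ≡ d₁ ⊎ z ≡ d₂
    unique {d₁} r₁ r₂ z p with IsTop? L' (isTop BL') z
    ... | no ¬tz = let w , r = C'.Lo.total ¬tz in
      Sum.map (preimage r r₁) (preimage r r₂)
              (C.rank-onCut (C'.Lo.rank⇒ r p))
    -- The top of `L'` has no counterpart in `S` and is treated separately: it is strictly above
    -- `d₁`, so its rank exceeds `C.ρ`.
    ... | yes tz with Leq⇒Path L' (tz d₁)
    ...   | zero  , ε = ⊥-elim (C'.Lo.nontop r₁ tz)
    ...   | suc j , q = ⊥-elim (m≢1+m+n C.ρ (trans
              (Path-unique L' (isBot BL') (isTop BL') gradedL' p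
                (_◁◁_ L' (C'.Lo.rank⇐ r₁ (C.onCut-rank (inj₁ refl))) q))
              (+-suc C.ρ j)))

  equal-cuts : C.ρ ≡ C'.ρ → ∀ {z} → C.OnCut z → C'.OnCut z
  equal-cuts ρ≡ρ' {z} cut = C'.rank-onCut (subst (C.Rank z) ρ≡ρ' (C.onCut-rank cut))

  equal-cuts-below : C.ρ ≡ C'.ρ → ∀ {z} → Below S C.c₁ C.c₂ z → Below S C'.c₁ C'.c₂ z
  equal-cuts-below ρ≡ρ' {z} = [ below (inj₁ refl) , below (inj₂ refl) ]′
    where
    below : ∀ {c} → C.OnCut c → Leq S z c → Below S C'.c₁ C'.c₂ z
    below cut z≤c = Sum.map (λ eq → subst (Leq S z) eq z≤c) (λ eq → subst (Leq S z) eq z≤c)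
                            (equal-cuts ρ≡ρ' cut)

  equal-cuts-above : C.ρ ≡ C'.ρ → ∀ {z} →
                     Below (dual S) C.c₁ C.c₂ z → Below (dual S) C'.c₁ C'.c₂ z
  equal-cuts-above ρ≡ρ' {z} = [ above (inj₁ refl) , above (inj₂ refl) ]′
    where
    above : ∀ {c} → C.OnCut c → Leq S c z → Below (dual S) C'.c₁ C'.c₂ z
    above cut c≤z = Sum.map (λ eq → subst (λ c → Leq S c z) eq c≤z)
                            (λ eq → subst (λ c → Leq S c z) eq c≤z) (equal-cuts ρ≡ρ' cut)

decomposition-unique : ∀ {l u l' u' s} {L : FinPoset l} {U : FinPoset u} {L' : FinPoset l'}
  {U' : FinPoset u'} {S : FinPoset s} (G : Gluing L U S) (G' : Gluing L' U' S) →
  Thick L → Thick U → Thick L' → Thick U' → Bounded S → Graded S →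
  ¬ HasNeck L → ¬ HasNeck L' → Iso L L' × Iso U U'
decomposition-unique {U = U} {U' = U'} G G' thickL thickU thickL' thickU' BS gradedS ¬neck ¬neck'
  with <-cmp (Cut.ρ G thickL thickU BS gradedS) (Cut.ρ G' thickL' thickU' BS gradedS)
... | tri< ρ<ρ' _ _ =
  ⊥-elim (¬neck' (lower-cut⇒neck G G' thickL thickU thickL' thickU' BS gradedS ρ<ρ'))
... | tri> _ _ ρ'<ρ =
  ⊥-elim (¬neck (lower-cut⇒neck G' G thickL' thickU' thickL thickU BS gradedS ρ'<ρ))
... | tri≈ _ ρ≡ρ' _ =
  Embedding-unique (bounded thickL) (bounded thickL') (Gluing.lower G) (Gluing.lower G')
    (equal-cuts-below G G' thickL thickU thickL' thickU' BS gradedS ρ≡ρ')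
    (equal-cuts-below G' G thickL' thickU' thickL thickU BS gradedS (sym ρ≡ρ'))
  , Iso-dual {P = U} {Q = U'} (Embedding-unique
      (Bounded-dual (bounded thickU)) (Bounded-dual (bounded thickU'))
      (Gluing.upper G) (Gluing.upper G')
      (equal-cuts-above G G' thickL thickU thickL' thickU' BS gradedS ρ≡ρ')
      (equal-cuts-above G' G thickL' thickU' thickL thickU BS gradedS (sym ρ≡ρ')))
  where open Thick

Iso-trans : ∀ {n m k} {P : FinPoset n} {Q : FinPoset m} {R : FinPoset k} →
            Iso P Q → Iso Q R → Iso P R
Iso-trans (σ , ord) (τ , ord') = τ ↔-∘ σ , λ x y → trans (ord x y) (ord' _ _)

-- Counting isomorphism types

private
  variable
    ℓ ℓ' : Level
    n : ℕ

-- The half of `IsoCount` that bounds from below, without exhaustion. The level is variable because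
-- `Composite` lives in `Set₁`.
record AtLeast (n : ℕ) (Q : FinPoset n → Set ℓ) (c : ℕ) : Set ℓ where
  constructor atLeast
  field
    reps     : Fin c → FinPoset n
    holds    : ∀ i → Q (reps i)
    distinct : ∀ i j → Iso (reps i) (reps j) → i ≡ j

AtLeast-zero : {Q : FinPoset n → Set ℓ} → AtLeast n Q 0
AtLeast-zero = atLeast (λ ()) (λ ()) λ ()

AtLeast-map : {Q : FinPoset n → Set ℓ} {Q' : FinPoset n → Set ℓ'} {c : ℕ} →
              (∀ X → Q X → Q' X) → AtLeast n Q c → AtLeast n Q' c
AtLeast-map f (atLeast reps q distinct) = atLeast reps (λ i → f (reps i) (q i)) distinct

AtLeast-⊎ : {Q : FinPoset n → Set ℓ} {Q' : FinPoset n → Set ℓ'} {a b : ℕ} →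
            (∀ X Y → Q X → Q' Y → ¬ Iso X Y) → AtLeast n Q a → AtLeast n Q' b →
            AtLeast n (λ X → Q X ⊎ Q' X) (a + b)
AtLeast-⊎ {n = n} {Q = Q} {Q'} {a} {b} disjoint (atLeast reps q distinct) (atLeast reps' q' distinct') =
  atLeast (rep ∘ splitAt a) (holds ∘ splitAt a)
  λ i j iso → trans (sym (join-splitAt a b i))
                (trans (cong (join a b) (dist (splitAt a i) (splitAt a j) iso)) (join-splitAt a b j))
  where
  rep : Fin a ⊎ Fin b → FinPoset n
  rep = [ reps , reps' ]′

  holds : ∀ i → Q (rep i) ⊎ Q' (rep i)
  holds (inj₁ i) = inj₁ (q i)
  holds (inj₂ j) = inj₂ (q' j)

  dist : ∀ i j → Iso (rep i) (rep j) → i ≡ j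
  dist (inj₁ i) (inj₁ j) iso = cong inj₁ (distinct i j iso)
  dist (inj₁ i) (inj₂ j) iso = ⊥-elim (disjoint _ _ (q i) (q' j) iso)
  dist (inj₂ i) (inj₁ j) iso =
    ⊥-elim (disjoint _ _ (q j) (q' i) (Iso-sym {P = reps' i} {Q = reps j} iso))
  dist (inj₂ i) (inj₂ j) iso = cong inj₂ (distinct' i j iso)

-- The bound `a ≤ k` kept in the predicate is what separates the first summand from the later ones,
-- via `sep`.
AtLeast-sumRange : {Q : ℕ → FinPoset n → Set ℓ} {g : ℕ → ℕ} →
  (∀ {k k'} X Y → Q k X → Q k' Y → Iso X Y → k ≡ k') →
  ∀ a l → (∀ k → a ≤ k → k < a + l → AtLeast n (Q k) (g k)) →
  AtLeast n (λ X → ∃ λ k → a ≤ k × Q k X) (sumRange a l g)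
AtLeast-sumRange sep a zero    each = AtLeast-zero
AtLeast-sumRange {Q = Q} sep a (suc l) each =
  AtLeast-map (λ { X (inj₁ q) → a , ≤-refl , q ; X (inj₂ (k , a<k , q)) → k , <⇒≤ a<k , q })
    (AtLeast-⊎ {Q = Q a} {Q' = λ X → ∃ λ k → suc a ≤ k × Q k X}
       (λ { X Y q (k , a<k , q') iso → <⇒≢ a<k (sep X Y q q' iso) })
       (each a ≤-refl (m<m+n a (s≤s z≤n)))
       (AtLeast-sumRange {Q = Q} sep (suc a) l
         λ k a<k k<a+l → each k (<⇒≤ a<k) (subst (k <_) (sym (+-suc a l)) k<a+l)))

AtLeast⇒≤ : {Q : FinPoset n → Set ℓ} {Q' : FinPoset n → Set} {c d : ℕ} →
            (∀ X → Q X → Q' X) → AtLeast n Q c → IsoCount n Q' d → c ≤ d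
AtLeast⇒≤ {n = n} {c = c} {d} Q⇒Q' (atLeast reps q distinct) (reps' , _ , _ , covers) =
  injective⇒≤ f-injective
  where
  f : Fin c → Fin d
  f i = proj₁ (covers (reps i) (Q⇒Q' (reps i) (q i)))

  f-iso : ∀ i → Iso (reps i) (reps' (f i))
  f-iso i = proj₂ (covers (reps i) (Q⇒Q' (reps i) (q i)))

  f-injective : ∀ {i j} → f i ≡ f j → i ≡ j
  f-injective {i} {j} eq = distinct i j
    (Iso-trans {P = reps i} {Q = reps' (f j)} {R = reps j}
      (subst (λ k → Iso (reps i) (reps' k)) eq (f-iso i))
      (Iso-sym {P = reps j} {Q = reps' (f j)} (f-iso j)))

-- Stacks of pieces in the family and the recursion

module _ (F : Family) (F-lattice : ∀ {n} (X : FinPoset n) → F X → IsLattice X × Graded X × VI X)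
         (closed : ClosedUnderV2Sum F) where

  Piece : FinPoset n → Set
  Piece X = F X × IsPiece X

  -- Members of F that may be put on top of a piece; this class contains the
  -- pieces and is preserved by putting a member on top of a piece.
  Stackable : FinPoset n → Set
  Stackable X = F X × ExactlyTwo X (IsAtom X) × AtomsBelowCoatoms X

  F⇒Bounded : {X : FinPoset n} → F X → Bounded X
  F⇒Bounded FX = lattice⇒Bounded (proj₁ (F-lattice _ FX))

  F⇒Graded : {X : FinPoset n} → F X → Graded X
  F⇒Graded FX = proj₁ (proj₂ (F-lattice _ FX))

  Piece⇒Stackable : {X : FinPoset n} → Piece X → Stackable X
  Piece⇒Stackable {X = X} (FX , _ , _ , _ , atoms , _ , _ , rank≥3) =
    FX , atoms , rank≥3⇒AtomsBelowCoatoms X (F⇒Bounded FX) (F⇒Graded FX) rank≥3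

  Piece⇒¬HasNeck : {X : FinPoset n} → Piece X → ¬ HasNeck X
  Piece⇒¬HasNeck (_ , _ , _ , _ , _ , _ , ¬neck , _) = ¬neck

  Stackable⇒Thick : {X : FinPoset n} → Stackable X → Thick X
  Stackable⇒Thick (FX , _ , abc) = record
    { bounded = F⇒Bounded FX ; graded = F⇒Graded FX ; atomsBelowCoatoms = abc }

  Piece⇒Thick : {X : FinPoset n} → Piece X → Thick X
  Piece⇒Thick = Stackable⇒Thick ∘ Piece⇒Stackable

  -- The index is the size of the bottom piece, that is, the summation variable of the recursion;
  -- isomorphic composites share it, so different summands do not overlap.
  record Composite (k : ℕ) (S : FinPoset n) : Set₁ where
    field
      {u}       : ℕ
      {L}       : FinPoset k
      {U}       : FinPoset u
      stackable : Stackable S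
      pieceL    : Piece L
      stackU    : Stackable U
      gluing    : Gluing L U S

  Composite-unique : ∀ {k k'} (S S' : FinPoset n) (c : Composite k S) (c' : Composite k' S') →
    Iso S S' → let open Composite in Iso (L c) (L c') × Iso (U c) (U c')
  Composite-unique S S' c c' iso = decomposition-unique
    (Gluing-Iso {S = S} {S' = S'} iso (gluing c)) (gluing c')
    (Piece⇒Thick (pieceL c)) (Stackable⇒Thick (stackU c))
    (Piece⇒Thick (pieceL c')) (Stackable⇒Thick (stackU c'))
    (F⇒Bounded (proj₁ (stackable c'))) (F⇒Graded (proj₁ (stackable c')))
    (Piece⇒¬HasNeck (pieceL c)) (Piece⇒¬HasNeck (pieceL c'))
    where open Composite

  Piece-not-Composite : ∀ {k} (X Y : FinPoset n) → Piece X → Composite k Y → ¬ Iso X Y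
  Piece-not-Composite X Y pX cY iso = Piece⇒¬HasNeck pX (Cut.hasNeck
    (Gluing-Iso {S = Y} {S' = X} (Iso-sym {P = X} {Q = Y} iso) gluing)
    (Piece⇒Thick pieceL) (Stackable⇒Thick stackU) (F⇒Bounded (proj₁ pX)) (F⇒Graded (proj₁ pX)))
    where open Composite cY

  abstract
    stack : ∀ {k m} → n + 4 ≡ k + m → {L : FinPoset k} {U : FinPoset m} →
            Piece L → Stackable U →
            Σ (FinPoset n) λ S → Stackable S × Gluing L U S
    stack {n = n} size {L} {U} pL@(FL , _ , _ , _ , atomsL , coatomsL , _) sU@(FU , atomsU , _)
      with closed L U FL FU coatomsL atomsU
    ... | nS , S , FS , sum = resize (+-cancelʳ-≡ 4 nS n (trans (Gluing-size G BL BU) (sym size)))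
      where
      BL : Bounded L
      BL = F⇒Bounded FL

      BU : Bounded U
      BU = F⇒Bounded FU

      G : Gluing L U S
      G = vertical2Sum⇒Gluing BL BU coatomsL sum

      module C = Cut G (Piece⇒Thick pL) (Stackable⇒Thick sU) (F⇒Bounded FS) (F⇒Graded FS)

      resize : nS ≡ n → Σ (FinPoset n) λ S → Stackable S × Gluing L U S
      resize refl = S , (FS , C.twoAtoms atomsL , C.atomsBelowCoatoms) , G

  AtLeast-Composite : ∀ {k m a b} → n + 4 ≡ k + m →
    AtLeast k Piece a → AtLeast m Stackable b → AtLeast n (Composite k) (a * b)
  AtLeast-Composite {n = n} {k} {a = a} {b} size (atLeast reps pc distinct) (atLeast reps' st distinct') =
    atLeast (proj₁ ∘ sum) (comp ∘ remQuot b) inj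
    where
    glue : ((i , j) : Fin a × Fin b) → Σ (FinPoset n) λ S → Stackable S × Gluing (reps i) (reps' j) S
    glue (i , j) = stack size (pc i) (st j)

    sum : ∀ i → _
    sum i = glue (remQuot b i)

    comp : ∀ ij → Composite k (proj₁ (glue ij))
    comp ij@(i , j) = record
      { stackable = proj₁ (proj₂ (glue ij)) ; pieceL = pc i ; stackU = st j
      ; gluing = proj₂ (proj₂ (glue ij)) }

    inj : ∀ i j → Iso (proj₁ (sum i)) (proj₁ (sum j)) → i ≡ j
    inj i j iso with Composite-unique (proj₁ (sum i)) (proj₁ (sum j)) (comp (remQuot b i)) (comp (remQuot b j)) iso
    ... | isoL , isoU = trans (sym (combine-remQuot {a} b i)) (trans
      (cong₂ combine (distinct _ _ isoL) (distinct' _ _ isoU)) (combine-remQuot {a} b j))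

  module _ (fpc : ℕ → ℕ) (count : ∀ n → 1 ≤ n → IsoCount n Piece (fpc n)) (N : ℕ) (6≤N : 6 ≤ N) where

    AtLeast-Piece : ∀ n → 1 ≤ n → AtLeast n Piece (fpc n)
    AtLeast-Piece n 1≤n = let reps , p , distinct , _ = count n 1≤n in atLeast reps p distinct

    -- `bound` keeps the truncated subtraction `n ∸ k` exact, so that a piece of size `k` and an
    -- upper part of size `n ∸ k + 4` glue to exactly `n` elements.
    AtLeast-Composites : ∀ {t n} l → (∀ {m} → 1 ≤ m → AtLeast m Stackable (lowerAux fpc N t m)) →
      (∀ {k} → k < 6 + l → k ≤ n) →
      AtLeast n (λ X → ∃ λ k → 6 ≤ k × Composite k X)
        (sumRange 6 l (λ k → fpc k * lowerAux fpc N t ((n ∸ k) + 4)))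
    AtLeast-Composites {t} {n} l smaller bound = AtLeast-sumRange
      (λ X Y c c' iso → ↔⇒≡ (proj₁ (proj₁ (Composite-unique X Y c c' iso)))) 6 l
      λ k 6≤k k<6+l → AtLeast-Composite (size (bound k<6+l))
        (AtLeast-Piece k (≤-trans (s≤s z≤n) 6≤k)) (smaller (≤-trans (s≤s z≤n) (m≤n+m 4 (n ∸ k))))
      where
      size : ∀ {k} → k ≤ n → n + 4 ≡ k + (n ∸ k + 4)
      size {k} k≤n = trans (cong (_+ 4) (sym (m+[n∸m]≡n k≤n))) (+-assoc k (n ∸ k) 4)

    -- Induction on the fuel. The value is a lower bound for every amount of fuel, since running out
    -- of it contributes 0.
    AtLeast-Stackable : ∀ t {n} → 1 ≤ n → AtLeast n Stackable (lowerAux fpc N t n)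
    AtLeast-Stackable zero    1≤n = AtLeast-zero
    AtLeast-Stackable (suc t) {n} 1≤n
      with n ≤ᵇ 6 | ≤ᵇ-reflects-≤ n 6 | n ≤ᵇ N | ≤ᵇ-reflects-≤ n N
    ... | true  | _        | _     | _        = AtLeast-map (λ _ → Piece⇒Stackable) (AtLeast-Piece n 1≤n)
    ... | false | ofⁿ n≰6 | true  | _        =
      AtLeast-map
        (λ { X (inj₁ p) → Piece⇒Stackable p ; X (inj₂ (_ , _ , c)) → Composite.stackable c })
        (AtLeast-⊎ (λ { X Y p (_ , _ , c) → Piece-not-Composite X Y p c }) (AtLeast-Piece n 1≤n)
          (AtLeast-Composites {t} (n ∸ 6) (AtLeast-Stackable t)
            -- As `n` exceeds 6, `6 + (n ∸ 6)` is `n`, so the sum stops at `n - 1`.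
            λ {k} k< → <⇒≤ (subst (k <_) (m+[n∸m]≡n (<⇒≤ (≰⇒> n≰6))) k<)))
    ... | false | ofⁿ n≰6 | false | ofⁿ n≰N =
      AtLeast-map (λ { X (_ , _ , c) → Composite.stackable c })
        (AtLeast-Composites {t} (N ∸ 5) (AtLeast-Stackable t)
          -- Here `6 + (N ∸ 5)` is `suc N`, so `k` is at most `N`, which is less than `n`.
          λ {k} k< → ≤-trans (<⇒≤pred (subst (k <_) (cong suc (m+[n∸m]≡n (<⇒≤ 6≤N))) k<))
                         (<⇒≤ (≰⇒> n≰N)))

theorem13 : (F : Family) →
    (∀ {n m} {X : FinPoset n} {Y : FinPoset m} → Iso X Y → F X → F Y) →
    (∀ {n} (X : FinPoset n) → F X → IsLattice X × Graded X × VI X) →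
    ClosedUnderV2Sum F →
    (fvi fpc : ℕ → ℕ) →
    (∀ n → 1 ≤ n → IsoCount n (λ X → F X) (fvi n)) →
    (∀ n → 1 ≤ n → IsoCount n (λ X → F X × IsPiece X) (fpc n)) →
    (N : ℕ) → 6 ≤ N →
    ∀ n → 1 ≤ n → lowerF fpc N n ≤ fvi n
theorem13 F _ F-lattice closed fvi fpc count count-pc N 6≤N n 1≤n =
  AtLeast⇒≤ (λ _ → proj₁)
    (AtLeast-Stackable F F-lattice closed fpc count-pc N 6≤N n 1≤n) (count n 1≤n)
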